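{- Let $p$ be an odd prime and let $b$ be a generator of the cyclic group $\mathrm{C}_{4p}$. Then the set of proper skew morphisms of $\mathrm{C}_{4p}$ is exactly the set consisting of all permutations $x_s$ (for $s=4i+2$ with $i\in\{0,\dots,p-1\}$, $i\neq (p-1)/2$), all permutations $y_s$ (for $s=4i$ with $i\in\{1,\dots,p-1\}$), and, if $p\equiv 1 \pmod 4$, also all permutations $z_{\omega,s}$ (for $\omega$ an integer with $\omega^2\equiv -1 \pmod p$ and $s=4i$ with $i\in\{1,\dots,p-1\}$); if $p\equiv 3\pmod 4$ there are no other proper skew morphisms besides the $x_s$ and $y_s$.
   Context: For a finite group $B$, a skew morphism of $B$ is a permutation $\varphi$ of $B$ fixing the identity such that for every $a\in B$ there is a positive integer $i_a$ with $\varphi(ab)=\varphi(a)\varphi^{i_a}(b)$ for all $b\in B$. A skew morphism is proper if it is not a group automorphism of $B$. The permutations are defined as follows, where $t$ ranges over all integers. For $s=4i+2$ ($i\in\{0,\dots,p-1\}$, $i\neq(p-1)/2$): $x_s(b^{2t+1})=b^{2t+1+s}$ and $x_s(b^{2t})=b^{2t}$. For $s=4i$ ($i\in\{1,\dots,p-1\}$): $y_s(b^{2t+1})=b^{2t+1+s}$ and $y_s(b^{2t})=b^{2t}$. For $p\equiv 1\pmod 4$, $\omega$ with $\omega^2\equiv-1\pmod p$, and $s=4i$ ($i\in\{1,\dots,p-1\}$): $z_{\omega,s}(b^{4t+1})=b^{4t+1+s}$, $z_{\omega,s}(b^{4t+2})=b^{4t+2+s(\omega+1)}$, $z_{\omega,s}(b^{4t+3})=b^{4t+3+s\omega}$,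 $z_{\omega,s}(b^{4t})=b^{4t}$. -}

module Defs where

open import Data.Nat using (ℕ; zero; suc; _+_; _*_; _<_; NonZero; nonTrivial⇒nonZero)
open import Data.Nat.Properties using (m*n≢0)
open import Data.Nat.DivMod using (_mod_; _%_)
open import Data.Nat.Primality using (Prime; prime)
open import Data.Fin using (Fin; toℕ)
open import Data.Product using (Σ; _×_)
open import Function.Definitions using (Bijective)
open import Relation.Binary.PropositionalEquality using (_≡_)
open import Relation.Nullary using (¬_)

-- The cyclic group C_n = ⟨b⟩ is modelled as Fin n, with b^k ↦ k mod n,
-- so the group operation is addition modulo n and the identity is 0.
module Cyclic (n : ℕ) .{{_ : NonZero n}} where

  _⊕_ : Fin n → Fin n → Fin n
  a ⊕ c = (toℕ a + toℕ c) mod n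

  e : Fin n
  e = 0 mod n

  iter : (Fin n → Fin n) → ℕ → Fin n → Fin n
  iter φ zero    x = x
  iter φ (suc i) x = φ (iter φ i x)

  IsSkewMorphism : (Fin n → Fin n) → Set
  IsSkewMorphism φ =
    Bijective _≡_ _≡_ φ × φ e ≡ e ×
    (∀ a → Σ ℕ λ i → 0 < i × (∀ c → φ (a ⊕ c) ≡ φ a ⊕ iter φ i c))

  IsAutomorphism : (Fin n → Fin n) → Set
  IsAutomorphism φ = Bijective _≡_ _≡_ φ × (∀ a c → φ (a ⊕ c) ≡ φ a ⊕ φ c)

  IsProperSkewMorphism : (Fin n → Fin n) → Set
  IsProperSkewMorphism φ = IsSkewMorphism φ × ¬ IsAutomorphism φ

  -- x_s : b^(2t+1) ↦ b^(2t+1+s), b^(2t) ↦ b^(2t)   (n even, so parity is well defined)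
  xperm : ℕ → Fin n → Fin n
  xperm s a with toℕ a % 2
  ... | 0 = a
  ... | _ = (toℕ a + s) mod n

  -- y_s : same defining formula as x_s (the paper uses different s-ranges)
  yperm : ℕ → Fin n → Fin n
  yperm s a with toℕ a % 2
  ... | 0 = a
  ... | _ = (toℕ a + s) mod n

  zperm : ℕ → ℕ → Fin n → Fin n
  zperm ω s a with toℕ a % 4
  ... | 1 = (toℕ a + s) mod n
  ... | 2 = (toℕ a + s * (ω + 1)) mod n
  ... | 3 = (toℕ a + s * ω) mod n
  ... | _ = a

nz4p : ∀ {p} → Prime p → NonZero (4 * p)
nz4p {p} (prime _) = m*n≢0 4 p {{_}} {{nonTrivial⇒nonZero p}}

-- A skew morphism is lifted to f : ℤ → ℤ and read modulo several moduli m.  Let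
-- Ker f = {c : f(c + y) ≡ f(c) + f(y) for all y}.  A power of f fixing 1 is the identity, so the
-- power attached to a is determined by f(a + 1) − f(a), a nonzero residue; by pigeonhole Ker f ≠ 0.
-- For a divisor d ∈ Ker f of m the same f is a skew morphism modulo d.  Using this with m = p, 2p
-- and 4p gives 4 ∈ Ker f when m = 4p.  So f(x + 4) = f(x) + f(4), and modulo 4 f is x ↦ x or x ↦ −x; comparing
-- the few values f(1), …, f(6) then leaves only linear maps and x_s, y_s, z_{ω,s}.
-- Conversely each of these is x ↦ x + s (1 + w + … + w^(x−1)) with w = −1 or w = ω, and the power
-- attached to a is w^a.
module Submission where

open import Data.Empty using (⊥)
open import Data.Fin as Fin using (Fin; toℕ; fromℕ<; punchOut)
open import Data.Fin.Properties as Fin using (pigeonhole; fromℕ<-injective; punchOut-injective)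
open import Data.Integer as ℤ using (ℤ; +_; _+_; _*_; _-_; -_; ∣_∣; -1ℤ; 0ℤ; 1ℤ)
open import Data.Integer.DivMod using (n%ℕd<d; a≡a%ℕn+[a/ℕn]*n; _%ℕ_; _/ℕ_)
open import Data.Integer.Divisibility.Signed using (_∣_; divides; ∣⇒∣ᵤ; ∣ᵤ⇒∣; _∣?_)
open import Data.Integer.Properties using (pos-+; pos-*; m-n≡m⊖n; ⊖-≥; *-cancelˡ-≡; abs-*)
import Data.Integer.Tactic.RingSolver as ℤ-Ring
open import Data.Nat as ℕ using (ℕ; zero; suc; NonZero)
open import Data.Nat.Coprimality using (coprime-Bézout; prime⇒coprime)
import Data.Nat.Divisibility as ℕ
open import Data.Nat.DivMod as ℕ using (_mod_)
open import Data.Nat.GCD using (module Bézout)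
open import Data.Nat.Induction using (Acc; acc; <-wellFounded)
open import Data.Nat.Primality
  using (Prime; euclidsLemma; prime⇒nonZero; prime⇒nonTrivial; prime⇒irreducible)
open import Data.Nat.Properties as ℕ using ()
import Data.Nat.Tactic.RingSolver as ℕ-Ring
open import Data.Product using (Σ; _×_; _,_; proj₁; proj₂)
open import Data.Sum using (_⊎_; inj₁; inj₂; [_,_]′)
open import Defs
open import Function.Bundles using (_⇔_; mk⇔; module Equivalence)
open import Relation.Binary.PropositionalEquality
  using (_≡_; _≢_; refl; sym; trans; cong; cong₂; subst; subst₂)
open import Relation.Nullary using (¬_; Dec; yes; no; contradiction)
open import Tactic.RingSolver.NonReflective ℤ-Ring.ring using (Expr; Κ; solve)
  renaming (_⊕_ to infixl 6 _:+_; _⊗_ to infixl 7 _:*_; ⊝_ to infix 8 :-_)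

-- The obstacle is that the pigeonhole yields only some nonzero kernel element. If it is prime to p,
-- the cofactor of p in the modulus is a multiple of it, hence also in the kernel. If p divides it,
-- only information at the prime 2 is left, and the rest is recovered by passing to the quotient of
-- half the order and lifting back. Once 4 is in the kernel, the unknown quantities f(x) - x (or
-- f(f(x)) - x when f is x ↦ -x modulo 4) are multiples of 4. A product with such a quantity modulo
-- 4p sees the other factor only modulo p, where Euclid's lemma separates the cases. If f is x ↦ x
-- modulo 4 and f(4) = 4, the decisive product is (1 + w)(1 + w²)(f(1) - 1): the factor 1 + w leads
-- to y_s, the factor 1 + w² to z_{ω,s}. If f is x ↦ -x modulo 4, only linear maps and x_s survive.
-- That ω² ≡ -1 forces p ≡ 1 modulo 4 is shown by a descent on the modulus.

infix  4 _:=_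
infixl 6 _:-_

_:=_ : ∀ {n} → Expr ℤ n → Expr ℤ n → Expr ℤ n × Expr ℤ n
_:=_ = _,_

_:-_ : ∀ {n} → Expr ℤ n → Expr ℤ n → Expr ℤ n
x :- y = x :+ :- y

-- Congruences of integers and their linear combinations.

infix 4 _≈_[_]

-- A record keeps x and y visible to unification; they could not be recovered from the difference
-- `x - y` alone.
record _≈_[_] (x y m : ℤ) : Set where
  constructor mk
  field diff : m ∣ x - y

≡⇒≈ : ∀ {x y m} → x ≡ y → x ≈ y [ m ]
≡⇒≈ {x} {m = m} refl = mk (divides (+ 0) (solve 2 (λ a b → a :- a := Κ 0ℤ :* b) refl x m))

-- Congruences are derived by exhibiting x - y as an explicit integer combination of differences
-- already known to be divisible by m. The last argument is then a plain identity over ℤ, left to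
-- the ring solver.
lin₁ : ∀ {x y a b m} → a ≈ b [ m ] → (k : ℤ) → x - y ≡ k * (a - b) → x ≈ y [ m ]
lin₁ {m = m} (mk (divides q e)) k h =
  mk (divides (k * q) (trans h (trans (cong (k *_) e)
    (solve 3 (λ a b c → a :* (b :* c) := a :* b :* c) refl k q m))))

lin₂ : ∀ {x y a b c d m} → a ≈ b [ m ] → c ≈ d [ m ] → (k l : ℤ) →
       x - y ≡ k * (a - b) + l * (c - d) → x ≈ y [ m ]
lin₂ {m = m} (mk (divides q e)) (mk (divides r g)) k l h =
  mk (divides (k * q + l * r)
       (trans h (trans (cong₂ _+_ (cong (k *_) e) (cong (l *_) g))
         (solve 5 (λ a b c d e → a :* (b :* c) :+ d :* (e :* c) := (a :* b :+ d :* e) :* c) refl k q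
           m l r))))

≈-refl : ∀ {x m} → x ≈ x [ m ]
≈-refl = ≡⇒≈ refl

≈-sym : ∀ {x y m} → x ≈ y [ m ] → y ≈ x [ m ]
≈-sym {x} {y} p = lin₁ p (- + 1) (solve 2 (λ a b → a :- b := Κ -1ℤ :* (b :- a)) refl y x)

≈-trans : ∀ {x y z m} → x ≈ y [ m ] → y ≈ z [ m ] → x ≈ z [ m ]
≈-trans {x} {y} {z} p q = lin₂ p q (+ 1) (+ 1)
  (solve 3 (λ a b c → a :- b := Κ 1ℤ :* (a :- c) :+ Κ 1ℤ :* (c :- b)) refl x z y)

lin₃ : ∀ {x y a b c d e g m} → a ≈ b [ m ] → c ≈ d [ m ] → e ≈ g [ m ] → (k l n : ℤ) →
       x - y ≡ k * (a - b) + l * (c - d) + n * (e - g) → x ≈ y [ m ]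
lin₃ {a = a} {b} {c} {d} {e} {g} p q r k l n h =
  lin₂ {a = k * (a - b) + l * (c - d)} {+ 0} (lin₂ p q k l
    (solve 6 (λ a b c d e g → a :* (b :- c) :+ d :* (e :- g) :- Κ 0ℤ := a :* (b :- c) :+ d :*
      (e :- g)) refl k a b l c d)) r (+ 1) n (trans h
    (solve 9 (λ a b c d e g h i j → a :* (b :- c) :+ d :* (e :- g) :+ h :* (i :- j) := Κ 1ℤ :*
      (a :* (b :- c) :+ d :* (e :- g) :- Κ 0ℤ) :+ h :* (i :- j)) refl k a b l c d n e g))

lin₄ : ∀ {x y a b c d e g i j m} →
       a ≈ b [ m ] → c ≈ d [ m ] → e ≈ g [ m ] → i ≈ j [ m ] → (k l n o : ℤ) →
       x - y ≡ k * (a - b) + l * (c - d) + n * (e - g) + o * (i - j) → x ≈ y [ m ]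
lin₄ {a = a} {b} {c} {d} {e} {g} {i} {j} p q r s k l n o h =
  lin₂ {a = k * (a - b) + l * (c - d) + n * (e - g)} {+ 0}
    (lin₃ p q r k l n
      (solve 9 (λ a b c d e g h i j → a :* (b :- c) :+ d :* (e :- g) :+ h :* (i :- j) :- Κ 0ℤ := a
        :* (b :- c) :+ d :* (e :- g) :+ h :* (i :- j)) refl k a b l c d n e g)) s (+ 1) o (trans h
      (solve 12 (λ a b c d e g h i j k l n → a :* (b :- c) :+ d :* (e :- g) :+ h :* (i :- j) :+ k :*
        (l :- n) := Κ 1ℤ :* (a :* (b :- c) :+ d :* (e :- g) :+ h :* (i :- j) :- Κ 0ℤ) :+ k :*
        (l :- n)) refl k a b l c d n e g o i j))

+-mono : ∀ {x y a b m} → x ≈ y [ m ] → a ≈ b [ m ] → x + a ≈ y + b [ m ]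
+-mono {x} {y} {a} {b} p q = lin₂ p q (+ 1) (+ 1)
  (solve 4 (λ a b c d → a :+ b :- (c :+ d) := Κ 1ℤ :* (a :- c) :+ Κ 1ℤ :* (b :- d)) refl x a y b)

*-monoʳ : ∀ k {x y m} → x ≈ y [ m ] → k * x ≈ k * y [ m ]
*-monoʳ k {x} {y} p = lin₁ p k (solve 3 (λ a b c → a :* b :- a :* c := a :* (b :- c)) refl k x y)

multiple : ∀ {m} k → k * m ≈ + 0 [ m ]
multiple {m} k = mk (divides k (solve 2 (λ a b → a :* b :- Κ 0ℤ := a :* b) refl k m))

≈-weaken : ∀ {x y} k {m} → x ≈ y [ k * m ] → x ≈ y [ m ]
≈-weaken k {m} (mk (divides q e)) = mk (divides (q * k) (trans e
  (solve 3 (λ a b c → a :* (b :* c) := a :* b :* c) refl q k m)))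

residue : ∀ x n .{{_ : NonZero n}} → x ≈ + (x %ℕ n) [ + n ]
residue x n = mk (divides (x /ℕ n) (move (a≡a%ℕn+[a/ℕn]*n x n)))
  where
  move : ∀ {y r s} → y ≡ r + s → y - r ≡ s
  move {r = r} {s} refl = solve 2 (λ a b → a :+ b :- a := b) refl r s

%-≡⇒≈ : ∀ {x y} n .{{_ : NonZero n}} → x %ℕ n ≡ y %ℕ n → x ≈ y [ + n ]
%-≡⇒≈ {x} {y} n e = ≈-trans (residue x n)
  (≈-trans (≡⇒≈ (cong +_ e)) (≈-sym (residue y n)))

-- Skew morphisms modulo m and the kernel of the power function.

iter : (ℤ → ℤ) → ℕ → ℤ → ℤ
iter f zero    x = x
iter f (suc k) x = f (iter f k x)

iter-+ : ∀ f i j x → iter f (i ℕ.+ j) x ≡ iter f i (iter f j x)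
iter-+ f zero    j x = refl
iter-+ f (suc i) j x = cong f (iter-+ f i j x)

-- f acts on integer representatives, so the same map can be read modulo different m. `resp` and
-- `inj` make it an injective map of residues, hence a permutation when m ≠ 0.
record Skew (m : ℤ) (f : ℤ → ℤ) : Set where
  field
    resp : ∀ {x y} → x ≈ y [ m ] → f x ≈ f y [ m ]
    inj  : ∀ {x y} → f x ≈ f y [ m ] → x ≈ y [ m ]
    f0   : f (+ 0) ≈ + 0 [ m ]
    π    : ℤ → ℕ
    skew : ∀ a c → f (a + c) ≈ f a + iter f (π a) c [ m ]

-- The kernel of the power function: for a skew morphism, c belongs to it exactly when f^(π c) and f
-- agree modulo m.
Ker : ℤ → (ℤ → ℤ) → ℤ → Set
Ker m f c = ∀ y → f (c + y) ≈ f c + f y [ m ]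

module SkewProperties {m : ℤ} {f : ℤ → ℤ} (S : Skew m f) where
  open Skew S

  resp-≡ : ∀ {x y} → x ≡ y → f x ≈ f y [ m ]
  resp-≡ e = ≡⇒≈ (cong f e)

  iter-resp : ∀ k {x y} → x ≈ y [ m ] → iter f k x ≈ iter f k y [ m ]
  iter-resp zero    p = p
  iter-resp (suc k) p = resp (iter-resp k p)

  iter-inj : ∀ k {x y} → iter f k x ≈ iter f k y [ m ] → x ≈ y [ m ]
  iter-inj zero    p = p
  iter-inj (suc k) p = iter-inj k (inj p)

  iter-0 : ∀ k → iter f k (+ 0) ≈ + 0 [ m ]
  iter-0 zero    = ≈-refl
  iter-0 (suc k) = ≈-trans (resp (iter-0 k)) f0

  opaque
    -- The powers add up along the orbit of a: s = π(a) + π(f(a)) + ... + π(f^(k-1)(a)).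
    iter-skew : ∀ k a → Σ ℕ λ s → ∀ x → iter f k (a + x) ≈ iter f k a + iter f s x [ m ]
    iter-skew zero    a = zero , λ x → ≈-refl
    iter-skew (suc k) a with iter-skew k a
    ... | s , h = π (iter f k a) ℕ.+ s , λ x →
      ≈-trans (resp (h x)) (≈-trans (skew _ _)
        (≡⇒≈ (cong (λ z → iter f (suc k) a + z) (sym (iter-+ f (π (iter f k a)) s x)))))

  iter-* : ∀ {k x} q → iter f k x ≈ x [ m ] → iter f (q ℕ.* k) x ≈ x [ m ]
  iter-* zero    p = ≈-refl
  iter-* {k} {x} (suc q) p =
    ≈-trans (≡⇒≈ (iter-+ f k (q ℕ.* k) x)) (≈-trans (iter-resp k (iter-* q p)) p)

  iter-% : ∀ M k .{{_ : NonZero k}} {x} → iter f k x ≈ x [ m ] →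
           iter f M x ≈ iter f (M ℕ.% k) x [ m ]
  iter-% M k {x} p = ≈-trans
    (≡⇒≈ (trans (cong (λ i → iter f i x) (ℕ.m≡m%n+[m/n]*n M k))
                (iter-+ f (M ℕ.% k) _ x)))
    (iter-resp (M ℕ.% k) (iter-* (M ℕ./ k) p))

  ker-resp : ∀ {a b} → a ≈ b [ m ] → Ker m f a → Ker m f b
  ker-resp p K y = ≈-trans (resp (+-mono (≈-sym p) ≈-refl))
    (≈-trans (K y) (+-mono (resp p) ≈-refl))

  ker-0 : Ker m f (+ 0)
  ker-0 y = lin₂ (resp-≡ {+ 0 + y} {y} (solve 1 (λ a → Κ 0ℤ :+ a := a) refl y)) f0 (+ 1) (- + 1)
    (solve 3 (λ a b c → a :- (b :+ c) := Κ 1ℤ :* (a :- c) :+ Κ -1ℤ :* (b :- Κ 0ℤ)) refl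
      (f (+ 0 + y)) (f (+ 0)) (f y))

  ker-+ : ∀ {a b} → Ker m f a → Ker m f b → Ker m f (a + b)
  ker-+ {a} {b} A B y =
    lin₄ (resp-≡ {a + b + y} {a + (b + y)}
      (solve 3 (λ a b c → a :+ b :+ c := a :+ (b :+ c)) refl a b y)) (A (b + y)) (B y) (A b)
      (+ 1) (+ 1) (+ 1) (- + 1)
        (solve 7 (λ a b c d e g h → a :- (b :+ c) := Κ 1ℤ :* (a :- d) :+ Κ 1ℤ :* (d :- (e :+ g)) :+
          Κ 1ℤ :* (g :- (h :+ c)) :+ Κ -1ℤ :* (b :- (e :+ h))) refl (f (a + b + y)) (f (a + b))
          (f y) (f (a + (b + y))) (f a) (f (b + y)) (f b))

  ker-*ℕ : ∀ {c} k → Ker m f c → Ker m f (+ k * c)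
  ker-*ℕ {c} zero    K = ker-resp (≡⇒≈ (solve 1 (λ a → Κ 0ℤ := Κ 0ℤ :* a) refl c)) ker-0
  ker-*ℕ {c} (suc k) K = ker-resp (≡⇒≈
    (solve 2 (λ a b → a :+ b :* a := (Κ 1ℤ :+ b) :* a) refl c (+ k))) (ker-+ K (ker-*ℕ k K))

  value-*ℕ : ∀ {c} k → Ker m f c → f (+ k * c) ≈ + k * f c [ m ]
  value-*ℕ {c} zero    K = ≈-trans (resp (≡⇒≈
    (solve 1 (λ a → Κ 0ℤ :* a := Κ 0ℤ) refl c))) (≈-trans f0 (≡⇒≈
    (solve 1 (λ a → Κ 0ℤ := Κ 0ℤ :* a) refl (f c))))
  value-*ℕ {c} (suc k) K =
    lin₃ (resp-≡ {+ suc k * c} {c + + k * c}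
      (solve 2 (λ a b → (Κ 1ℤ :+ a) :* b := b :+ a :* b) refl (+ k) c)) (K (+ k * c)) (value-*ℕ k K)
      (+ 1) (+ 1) (+ 1)
        (solve 5 (λ a b c d e → a :- (Κ 1ℤ :+ b) :* c := Κ 1ℤ :* (a :- d) :+ Κ 1ℤ :* (d :- (c :+ e))
          :+ Κ 1ℤ :* (e :- b :* c)) refl (f (+ suc k * c)) (+ k) (f c) (f (c + + k * c))
          (f (+ k * c)))

-- Finite order, and powers of f determined by their value at 1.

module FiniteSkew {n : ℕ} .{{_ : NonZero n}} {f : ℤ → ℤ} (S : Skew (+ n) f) where
  open Skew S
  open SkewProperties S

  -- Negative integers are reached through their nonnegative residues, so that `ker-*` and `value-*`
  -- rest on induction over ℕ.
  residues : {P : ℤ → Set} → (∀ {x y} → x ≈ y [ + n ] → P x → P y) → (∀ k → P (+ k)) → ∀ x → P x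
  residues r h x = r (≈-sym (residue x n)) (h _)

  ker-* : ∀ {c} k → Ker (+ n) f c → Ker (+ n) f (k * c)
  ker-* {c} k K = residues {λ k → Ker (+ n) f (k * c)}
    (λ {x} {y} p → ker-resp {x * c} {y * c} (lin₁ p c
      (solve 3 (λ a b c → a :* b :- c :* b := b :* (a :- c)) refl x c y))) (λ i → ker-*ℕ i K) k

  value-* : ∀ {c} k → Ker (+ n) f c → f (k * c) ≈ k * f c [ + n ]
  value-* {c} k K = residues {λ k → f (k * c) ≈ k * f c [ + n ]}
    (λ {x} {y} p q → lin₃ (resp {y * c} {x * c} (lin₁ p (- c)
      (solve 3 (λ a b c → a :* b :- c :* b := (:- b) :* (c :- a)) refl y c x)
      )) q p (+ 1) (+ 1) (f c)
      (solve 5 (λ a b c d e → a :- b :* c := Κ 1ℤ :* (a :- d) :+ Κ 1ℤ :* (d :- e :* c) :+ c :*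
        (e :- b)) refl (f (y * c)) y (f c) (f (x * c)) x))
    (λ i → value-*ℕ i K) k

  opaque
    -- Two of the iterates f^0(x), ..., f^n(x) agree modulo n; injectivity cancels the smaller
    -- power.
    orbit : ∀ x → Σ ℕ λ k → iter f (suc k) x ≈ x [ + n ]
    orbit x with pigeonhole (ℕ.n<1+n n) (λ k → fromℕ< (n%ℕd<d (iter f (toℕ k) x) n))
    ... | i , j , i<j , e = toℕ j ℕ.∸ suc (toℕ i) , ≈-sym (iter-inj (toℕ i) (≈-trans
          (%-≡⇒≈ n (fromℕ<-injective _ _ _ _ e))
          (≡⇒≈ (trans (cong (λ k → iter f k x) (trans (sym (ℕ.m+[n∸m]≡n i<j)) (sym (ℕ.+-suc (toℕ i) _))))
                      (iter-+ f (toℕ i) _ x)))))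

  Period : ℕ → Set
  Period k = ∀ x → iter f k x ≈ x [ + n ]

  opaque
    -- The product of orbit lengths of the residues 0, ..., n - 1 is a common period.
    period : Σ ℕ λ k → Period (suc k)
    period = extend (below n)
      where
      below : ∀ b → Σ ℕ λ k → ∀ i → i ℕ.< b → iter f (suc k) (+ i) ≈ + i [ + n ]
      below zero = 0 , λ i ()
      below (suc b) with below b | orbit (+ b)
      -- Periods are recorded as successors: `suc (l + k * suc l)` is the product `suc k * suc l`.
      ... | k , p | l , q = l ℕ.+ k ℕ.* suc l , cases
        where
        commute : ∀ x → iter f (suc l ℕ.* suc k) x ≈ x [ + n ] → iter f (suc k ℕ.* suc l) x ≈ x [ + n ]
        commute x = subst (λ t → iter f t x ≈ x [ + n ]) (ℕ.*-comm (suc l) (suc k))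
        cases : ∀ i → i ℕ.< suc b → iter f (suc k ℕ.* suc l) (+ i) ≈ + i [ + n ]
        cases i i<1+b with ℕ.m≤n⇒m<n∨m≡n (ℕ.s≤s⁻¹ i<1+b)
        ... | inj₁ i<b  = commute (+ i) (iter-* {suc k} {+ i} (suc l) (p i i<b))
        ... | inj₂ refl = iter-* {suc l} {+ i} (suc k) q
      extend : (Σ ℕ λ k → ∀ i → i ℕ.< n → iter f (suc k) (+ i) ≈ + i [ + n ]) → Σ ℕ λ k → Period (suc k)
      extend (k , p) = k , λ x → ≈-trans (iter-resp (suc k) (residue x n))
        (≈-trans (p _ (n%ℕd<d x n)) (≈-sym (residue x n)))

  -- Translation by 1 conjugates fᵏ into a power fˢ when fᵏ fixes 1.  Along a period M divisible
  -- by k this gives the period (M / k) · s; reducing it modulo M leads, by descent on M, to k ∣ s,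
  -- and then x ↦ 1 + x preserves the fixed points of fᵏ.
  fixes-1⇒period : ∀ k → iter f k (+ 1) ≈ + 1 [ + n ] → Period k
  fixes-1⇒period k = go k (<-wellFounded k)
    where
    transport : ∀ k {s} → iter f k (+ 1) ≈ + 1 [ + n ] →
                (∀ x → iter f k (+ 1 + x) ≈ iter f k (+ 1) + iter f s x [ + n ]) →
                ∀ q x → iter f (q ℕ.* k) (+ 1 + x) ≈ + 1 + iter f (q ℕ.* s) x [ + n ]
    transport k fix h zero x = ≈-refl
    transport k {s} fix h (suc q) x =
      ≈-trans (≡⇒≈ (iter-+ f k (q ℕ.* k) (+ 1 + x))) (
      ≈-trans (iter-resp k (transport k {s} fix h q x)) (
      lin₃ (h (iter f (q ℕ.* s) x)) fix
           (≡⇒≈ {iter f (s ℕ.+ q ℕ.* s) x} {iter f s (iter f (q ℕ.* s) x)} (iter-+ f s (q ℕ.* s) x))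
           (+ 1) (+ 1) (- + 1)
             (solve 4 (λ a c d e → a :- (Κ 1ℤ :+ e) := Κ 1ℤ :* (a :- (c :+ d)) :+ Κ 1ℤ :*
               (c :- Κ 1ℤ) :+ Κ -1ℤ :* (e :- d)) refl (iter f k (+ 1 + iter f (q ℕ.* s) x))
               (iter f k (+ 1)) (iter f s (iter f (q ℕ.* s) x)) (iter f (s ℕ.+ q ℕ.* s) x))))

    propagate : ∀ k t → iter f k (+ 1) ≈ + 1 [ + n ] →
                (∀ x → iter f k (+ 1 + x) ≈ iter f k (+ 1) + iter f (t ℕ.* k) x [ + n ]) → Period k
    propagate k t fix h x = ≈-trans (iter-resp k (residue x n)) (≈-trans (ind _) (≈-sym (residue x n)))
      where
      ind : ∀ j → iter f k (+ j) ≈ + j [ + n ]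
      ind zero    = iter-0 k
      ind (suc j) = lin₃ h-j fix (iter-* {k} t (ind j)) (+ 1) (+ 1) (+ 1)
        (solve 4 (λ a b c d → a :- (Κ 1ℤ :+ b) := Κ 1ℤ :* (a :- (c :+ d)) :+ Κ 1ℤ :* (c :- Κ 1ℤ) :+
          Κ 1ℤ :* (d :- b)) refl (iter f k (+ suc j)) (+ j) (iter f k (+ 1))
          (iter f (t ℕ.* k) (+ j)))
        where
        h-j : iter f k (+ suc j) ≈ iter f k (+ 1) + iter f (t ℕ.* k) (+ j) [ + n ]
        h-j = h (+ j)

    go : ∀ k → Acc ℕ._<_ k → iter f k (+ 1) ≈ + 1 [ + n ] → Period k
    go zero    _        fix x = ≈-refl
    go k@(suc _) (acc rec) fix with iter-skew k (+ 1)
    ... | s , h with period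
    ... | M , per = down (suc M) (<-wellFounded (suc M)) per
      where
      down : ∀ M .{{_ : NonZero M}} → Acc ℕ._<_ M → Period M → Period k
      down M (acc recM) per with M ℕ.% k in M%k | ℕ.m%n<n M k
      -- If k does not divide M, then f^r with r = M mod k fixes 1, and so does f^(k mod r). Both
      -- exponents are below k, so by induction both powers are the identity, and hence so is f^k.
      ... | r@(suc _) | r<k = λ x → ≈-trans (iter-% k r {x} (perR x)) (perK x)
        where
        fixR : iter f r (+ 1) ≈ + 1 [ + n ]
        fixR = ≈-trans
          (≈-sym (subst (λ t → iter f M (+ 1) ≈ iter f t (+ 1) [ + n ]) M%k (iter-% M k fix)))
                       (per (+ 1))
        perR : Period r
        perR = go r (rec r<k) fixR
        perK : Period (k ℕ.% r)
        perK = go (k ℕ.% r) (rec (ℕ.<-trans (ℕ.m%n<n k r) r<k))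
                 (≈-trans (≈-sym (iter-% k r fixR)) fix)
      ... | zero | _ = step ((q ℕ.* s) ℕ.% M) refl
        where
        q = M ℕ./ k
        M≡q*k : M ≡ q ℕ.* k
        M≡q*k = trans (ℕ.m≡m%n+[m/n]*n M k) (cong (ℕ._+ q ℕ.* k) M%k)
        perS : Period (q ℕ.* s)
        perS x = lin₂ (transport k {s} fix h q x)
          (subst (λ t → iter f t (+ 1 + x) ≈ + 1 + x [ + n ]) M≡q*k (per (+ 1 + x)))
          (- + 1) (+ 1)
            (solve 3 (λ a b c → a :- b := Κ -1ℤ :* (c :- (Κ 1ℤ :+ a)) :+ Κ 1ℤ :* (c :- (Κ 1ℤ :+ b)))
              refl (iter f (q ℕ.* s) x) x (iter f (q ℕ.* k) (+ 1 + x)))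
        step : ∀ t → (q ℕ.* s) ℕ.% M ≡ t → Period k
        step (suc t) e = down (suc t) (recM (subst (ℕ._< M) e (ℕ.m%n<n (q ℕ.* s) M)))
          (λ x → ≈-trans (subst (λ t → iter f t x ≈ iter f (q ℕ.* s) x [ + n ]) e
                            (≈-sym (iter-% (q ℕ.* s) M (per x)))) (perS x))
        step zero e with k∣s
          where
          nz : NonZero q
          nz = ℕ.≢-nonZero λ q≡0 → ℕ.≢-nonZero⁻¹ M (trans M≡q*k (cong (ℕ._* k) q≡0))
          k∣s : k ℕ.∣ s
          k∣s = ℕ.*-cancelˡ-∣ q {{nz}} (subst (ℕ._∣ q ℕ.* s) M≡q*k (ℕ.m%n≡0⇒n∣m (q ℕ.* s) M e))
        ... | ℕ.divides t refl = propagate k t fix h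

  -- The skew law at 1 shows that f^(π a) and f^(π b) agree at 1; cancelling the smaller power makes
  -- them agree everywhere. Hence f(a + x) - f(a) = f(b + x) - f(b) for all x, and subtracting the
  -- cases x = y - b and x = -b gives additivity at a - b.
  equal-increments⇒ker : ∀ a b → f (a + + 1) - f a ≈ f (b + + 1) - f b [ + n ] → Ker (+ n) f (a - b)
  equal-increments⇒ker a b p y =
    lin₄ (resp-≡ {a - b + y} {a + (y - b)}
      (solve 3 (λ a b c → a :- b :+ c := a :+ (c :- b)) refl a b y)) (same (y - b)) same-b
         at-y (+ 1) (+ 1) (- + 1) (+ 1)
           (solve 8 (λ a b c d e g h i → a :- (b :+ c) := Κ 1ℤ :* (a :- d) :+ Κ 1ℤ :*
             (d :- (e :- g :+ h)) :+ Κ -1ℤ :* (b :- (e :- g :+ i)) :+ Κ 1ℤ :* (h :- i :- c)) refl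
             (f (a - b + y)) (f (a - b)) (f y) (f (a + (y - b))) (f a) (f b) (f (b + (y - b)))
             (f (b - b)))
    where
    at-1 : iter f (π a) (+ 1) ≈ iter f (π b) (+ 1) [ + n ]
    at-1 = lin₃ (skew a (+ 1)) (skew b (+ 1)) p (- + 1) (+ 1) (+ 1)
      (solve 6 (λ a b c d e g → a :- b := Κ -1ℤ :* (c :- (d :+ a)) :+ Κ 1ℤ :* (e :- (g :+ b)) :+ Κ
        1ℤ :* (c :- d :- (e :- g))) refl (iter f (π a) (+ 1)) (iter f (π b) (+ 1)) (f (a + + 1))
        (f a) (f (b + + 1)) (f b))

    powers : ∀ {i j} → i ℕ.≤ j → iter f i (+ 1) ≈ iter f j (+ 1) [ + n ] →
             ∀ x → iter f i x ≈ iter f j x [ + n ]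
    powers {i} {j} i≤j p x = ≈-trans (iter-resp i (≈-sym (fixes-1⇒period (j ℕ.∸ i) fix x)))
                                     (≈-sym (split x))
      where
      split : ∀ x → iter f j x ≈ iter f i (iter f (j ℕ.∸ i) x) [ + n ]
      split x = ≡⇒≈ (trans (cong (λ k → iter f k x) (sym (ℕ.m+[n∸m]≡n i≤j))) (iter-+ f i _ x))
      fix : iter f (j ℕ.∸ i) (+ 1) ≈ + 1 [ + n ]
      fix = iter-inj i (≈-trans (≈-sym (split (+ 1))) (≈-sym p))

    equal : ∀ x → iter f (π a) x ≈ iter f (π b) x [ + n ]
    equal x with ℕ.≤-total (π a) (π b)
    ... | inj₁ le = powers le at-1 x
    ... | inj₂ le = ≈-sym (powers le (≈-sym at-1) x)

    same : ∀ x → f (a + x) ≈ f a - f b + f (b + x) [ + n ]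
    same x = lin₃ (skew a x) (skew b x) (equal x) (+ 1) (- + 1) (+ 1)
      (solve 6 (λ a b c d e g → a :- (b :- c :+ d) := Κ 1ℤ :* (a :- (b :+ e)) :+ Κ -1ℤ :*
        (d :- (c :+ g)) :+ Κ 1ℤ :* (e :- g)) refl (f (a + x)) (f a) (f b) (f (b + x))
        (iter f (π a) x) (iter f (π b) x))

    same-b : f (a - b) ≈ f a - f b + f (b - b) [ + n ]
    same-b = same (- b)

    at-y : f (b + (y - b)) - f (b - b) ≈ f y [ + n ]
    at-y = lin₃ (resp-≡ {b + (y - b)} {y}
      (solve 2 (λ a b → a :+ (b :- a) := b) refl b y)) (resp-≡ {b - b} {+ 0}
      (solve 1 (λ a → a :- a := Κ 0ℤ) refl b)) f0
                (+ 1) (- + 1) (- + 1)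
                  (solve 4 (λ a b c d → a :- b :- c := Κ 1ℤ :* (a :- c) :+ Κ -1ℤ :* (b :- d) :+ Κ
                    -1ℤ :* (d :- Κ 0ℤ)) refl (f (b + (y - b))) (f (b - b)) (f y) (f (+ 0)))

-- Change of modulus, uniqueness of residues, parity.

infix 4 _≈?_[_]
_≈?_[_] : ∀ x y m → Dec (x ≈ y [ m ])
x ≈? y [ m ] with m ∣? (x - y)
... | yes d = yes (mk d)
... | no ¬d = no λ { (mk d) → ¬d d }

≈-modulus : ∀ {x y m k} → m ≡ k → x ≈ y [ m ] → x ≈ y [ k ]
≈-modulus refl p = p

scale : ∀ {x y m} k → x ≈ y [ m ] → k * x ≈ k * y [ k * m ]
scale {x} {y} {m} k (mk (divides q e)) = mk (divides q (trans {j = k * (x - y)}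
  (solve 3 (λ a b c → a :* b :- a :* c := a :* (b :- c)) refl k x y) (trans (cong (k *_) e)
  (solve 3 (λ a b c → a :* (b :* c) := b :* (a :* c)) refl k q m))))

unscale : ∀ {x y m} k .{{_ : ℤ.NonZero k}} → k * x ≈ k * y [ k * m ] → x ≈ y [ m ]
unscale {x} {y} {m} k (mk (divides q e)) = mk (divides q (*-cancelˡ-≡ k (x - y) (q * m)
  (trans {j = k * x - k * y}
    (solve 3 (λ a b c → a :* (b :- c) := a :* b :- a :* c) refl k x y) (trans e
    (solve 3 (λ a b c → a :* (b :* c) := b :* (a :* c)) refl q k m)))))

exact : ∀ {x m} → x ≈ + 0 [ m ] → Σ ℤ λ q → x ≡ q * m
exact {x} {m} (mk (divides q e)) = q , trans {j = x - + 0} (solve 1 (λ a → a := a :- Κ 0ℤ) refl x) e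

≈⇒∣ : ∀ {x m} → x ≈ + 0 [ m ] → m ∣ x
≈⇒∣ p with exact p
... | q , e = divides q e

∣⇒≈ : ∀ {x m} → m ∣ x → x ≈ + 0 [ m ]
∣⇒≈ {x} {m} (divides q e) = mk (divides q (trans {j = x} (solve 1 (λ a → a :- Κ 0ℤ := a) refl x) e))

residues-unique : ∀ {n a b} → a ℕ.< n → b ℕ.< n → + a ≈ + b [ + n ] → a ≡ b
residues-unique {n} {a} {b} a<n b<n p =
  [ (λ a≤b → ordered a≤b b<n (≈-sym p)) , (λ b≤a → sym (ordered b≤a a<n p)) ]′ (ℕ.≤-total a b)
  where
  ordered : ∀ {a b} → a ℕ.≤ b → b ℕ.< n → + b ≈ + a [ + n ] → a ≡ b
  ordered {a} {b} a≤b b<n (mk d)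
    with b ℕ.∸ a in e | subst (n ℕ.∣_) (cong ∣_∣ (trans (m-n≡m⊖n b a) (⊖-≥ a≤b))) (∣⇒∣ᵤ d)
  ... | zero  | _   = ℕ.≤-antisym a≤b (ℕ.m∸n≡0⇒m≤n e)
  ... | suc k | n∣k = contradiction n∣k
    (ℕ.>⇒∤ (subst (ℕ._< n) e (ℕ.≤-<-trans (ℕ.m∸n≤m b a) b<n)))

n≢0⇒≉0 : ∀ {n k} → k ℕ.< n → k ≢ 0 → ¬ + k ≈ + 0 [ + n ]
n≢0⇒≉0 k<n k≢0 p = k≢0 (residues-unique k<n (ℕ.≤-<-trans ℕ.z≤n k<n) p)

division : ∀ x n .{{_ : NonZero n}} → Σ ℕ λ r → r ℕ.< n × Σ ℤ λ t → x ≡ + r + t * + n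
division x n = x %ℕ n , n%ℕd<d x n , x /ℕ n , a≡a%ℕn+[a/ℕn]*n x n

parity : ∀ q → (Σ ℤ λ t → q ≡ + 2 * t) ⊎ (Σ ℤ λ t → q ≡ + 1 + + 2 * t)
parity q = split (division q 2)
  where
  split : (Σ ℕ λ r → r ℕ.< 2 × Σ ℤ λ t → q ≡ + r + t * + 2) → _
  split (0 , _ , t , e) = inj₁ (t , trans e
    (solve 1 (λ a → Κ 0ℤ :+ a :* Κ (+ 2) := Κ (+ 2) :* a) refl t))
  split (1 , _ , t , e) = inj₂ (t , trans e
    (solve 1 (λ a → Κ 1ℤ :+ Κ 0ℤ :+ a :* Κ (+ 2) := Κ 1ℤ :+ Κ (+ 2) :* a) refl t))
  split (suc (suc _) , ℕ.s≤s (ℕ.s≤s ()) , _)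

-- Write x - y = q m and y - z = r m. If q and r are both odd, then q + r is even.
three-halves : ∀ {x y z m} → x ≈ y [ m ] → y ≈ z [ m ] →
               x ≈ y [ + 2 * m ] ⊎ y ≈ z [ + 2 * m ] ⊎ x ≈ z [ + 2 * m ]
three-halves {x} {y} {z} {m} (mk (divides q e)) (mk (divides r g)) = choose (parity q) (parity r) e g
  where
  choose : ∀ {q r} → (Σ ℤ λ t → q ≡ + 2 * t) ⊎ (Σ ℤ λ t → q ≡ + 1 + + 2 * t) →
           (Σ ℤ λ t → r ≡ + 2 * t) ⊎ (Σ ℤ λ t → r ≡ + 1 + + 2 * t) →
           x - y ≡ q * m → y - z ≡ r * m →
           x ≈ y [ + 2 * m ] ⊎ y ≈ z [ + 2 * m ] ⊎ x ≈ z [ + 2 * m ]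
  choose (inj₁ (t , refl)) _               e g = inj₁ (mk (divides t (trans e
    (solve 2 (λ a b → Κ (+ 2) :* a :* b := a :* (Κ (+ 2) :* b)) refl t m))))
  choose (inj₂ _)          (inj₁ (t , refl)) e g = inj₂ (inj₁ (mk (divides t (trans g
    (solve 2 (λ a b → Κ (+ 2) :* a :* b := a :* (Κ (+ 2) :* b)) refl t m)))))
  choose (inj₂ (t , refl)) (inj₂ (u , refl)) e g = inj₂ (inj₂ (mk (divides (t + u + + 1)
    (trans {j = (x - y) + (y - z)}
      (solve 3 (λ a b c → a :- b := a :- c :+ (c :- b)) refl x z y) (trans (cong₂ _+_ e g)
      (solve 3 (λ a b c → (Κ 1ℤ :+ Κ (+ 2) :* a) :* b :+ (Κ 1ℤ :+ Κ (+ 2) :* c) :* b :=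
        (a :+ c :+ Κ 1ℤ) :* (Κ (+ 2) :* b)) refl t m u))))))

-- Nontrivial kernels, quotients and lifting.

ker-nontrivial : ∀ {n} .{{_ : NonZero n}} {f} → 1 ℕ.< n → Skew (+ n) f →
                 Σ ℤ λ c → Ker (+ n) f c × ¬ c ≈ + 0 [ + n ]
-- Injectivity keeps each increment away from 0, so `punchOut` leaves one value fewer than there are
-- arguments.
ker-nontrivial {suc n} {f} 1<n S = conclude (pigeonhole (ℕ.n<1+n n) (λ a → punchOut (nonzero a)))
  where
  open Skew S
  open FiniteSkew S
  increment : ℕ → ℤ
  increment a = f (+ a + + 1) - f (+ a)
  value : Fin (suc n) → Fin (suc n)
  value a = fromℕ< (n%ℕd<d (increment (toℕ a)) (suc n))
  increment≉0 : ∀ a → ¬ f (+ a + + 1) - f (+ a) ≈ + 0 [ + suc n ]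
  increment≉0 a p = n≢0⇒≉0 1<n (λ ()) (lin₁ (inj {+ a + + 1} {+ a} (lin₁ p (+ 1)
    (solve 2 (λ a b → a :- b := Κ 1ℤ :* (a :- b :- Κ 0ℤ)) refl (f (+ a + + 1)) (f (+ a))))) (+ 1)
    (solve 1 (λ a → Κ 1ℤ :- Κ 0ℤ := Κ 1ℤ :* (a :+ Κ 1ℤ :- a)) refl (+ a)))
  nonzero : ∀ a → Fin.zero ≢ value a
  nonzero a e = increment≉0 (toℕ a)
    (%-≡⇒≈ (suc n) (trans (sym (Fin.toℕ-fromℕ< _)) (cong toℕ (sym e))))

  conclude : (Σ (Fin (suc n)) λ i → Σ (Fin (suc n)) λ j →
              i Fin.< j × punchOut (nonzero i) ≡ punchOut (nonzero j)) →
             Σ ℤ λ c → Ker (+ suc n) f c × ¬ c ≈ + 0 [ + suc n ]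
  conclude (i , j , i<j , e) =
    + toℕ i - + toℕ j
    , equal-increments⇒ker (+ toℕ i) (+ toℕ j)
        (%-≡⇒≈ (suc n) (fromℕ<-injective _ _ _ _ (punchOut-injective (nonzero i) (nonzero j) e)))
    , λ p → ℕ.<⇒≢ i<j (residues-unique (Fin.toℕ<n i) (Fin.toℕ<n j) (lin₁ p (+ 1)
      (solve 2 (λ a b → a :- b := Κ 1ℤ :* (a :- b :- Κ 0ℤ)) refl (+ toℕ i) (+ toℕ j))))

-- From e f(d) = f(e d) = 0 modulo e d it follows that d divides f(d), so f(t d + y) = t f(d) + f(y)
-- depends modulo d only on y. Injectivity survives because some positive power of f is the identity
-- modulo N, hence modulo d.
skew-quotient : ∀ {N} .{{_ : NonZero N}} {f} e d .{{_ : ℤ.NonZero e}} → + N ≡ e * d → Skew (+ N) f →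
                Ker (+ N) f d → Skew d f
skew-quotient {N} {f} e d N≡e*d S K = record
  { resp = resp′
  ; inj  = λ p → cancel (periodic p)
  ; f0   = weaken f0
  ; π    = π
  ; skew = λ a c → weaken (skew a c)
  }
  where
  open Skew S
  open SkewProperties S
  open FiniteSkew S
  weaken : ∀ {x y} → x ≈ y [ + N ] → x ≈ y [ d ]
  weaken p = ≈-weaken e (≈-modulus N≡e*d p)

  fd≈0 : f d ≈ + 0 [ d ]
  fd≈0 = unscale e (≈-modulus N≡e*d efd≈0)
    where
    ed≈0 : e * d ≈ + 0 [ + N ]
    ed≈0 = ≈-modulus (sym N≡e*d) (lin₁ (multiple (+ 1)) (+ 1)
      (solve 2 (λ a b → a :* b :- Κ 0ℤ := Κ 1ℤ :* (Κ 1ℤ :* (a :* b) :- Κ 0ℤ)) refl e d))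
    efd≈0 : e * f d ≈ e * + 0 [ + N ]
    efd≈0 = lin₃ (value-* e K) (resp ed≈0) f0 (- + 1) (+ 1) (+ 1)
      (solve 4 (λ a b c d → a :* b :- a :* Κ 0ℤ := Κ -1ℤ :* (c :- a :* b) :+ Κ 1ℤ :* (c :- d) :+ Κ
        1ℤ :* (d :- Κ 0ℤ)) refl e (f d) (f (e * d)) (f (+ 0)))

  resp′ : ∀ {x y} → x ≈ y [ d ] → f x ≈ f y [ d ]
  resp′ {x} {y} (mk (divides t h)) =
    lin₄ (≡⇒≈ (cong f (move h))) (weaken (ker-* t K y)) (weaken (value-* t K)) fd≈0 (+ 1) (+ 1) (+ 1) t
      (solve 6 (λ a b c d e g → a :- b := Κ 1ℤ :* (a :- c) :+ Κ 1ℤ :* (c :- (d :+ b)) :+ Κ 1ℤ :*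
        (d :- e :* g) :+ e :* (g :- Κ 0ℤ)) refl (f x) (f y) (f (t * d + y)) (f (t * d)) t (f d))
    where
    move : ∀ {a} → x - y ≡ a → x ≡ a + y
    move refl = solve 2 (λ a b → a := a :- b :+ b) refl x y

  iter-resp′ : ∀ k {x y} → x ≈ y [ d ] → iter f k x ≈ iter f k y [ d ]
  iter-resp′ zero    p = p
  iter-resp′ (suc k) p = resp′ (iter-resp′ k p)

  iter-suc : ∀ k x → iter f k (f x) ≡ iter f (suc k) x
  iter-suc zero    x = refl
  iter-suc (suc k) x = cong f (iter-suc k x)

  M = proj₁ period
  periodic : ∀ {x y} → f x ≈ f y [ d ] → iter f (suc M) x ≈ iter f (suc M) y [ d ]
  periodic {x} {y} p = subst₂ (λ a b → a ≈ b [ d ]) (iter-suc M x) (iter-suc M y) (iter-resp′ M p)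
  cancel : ∀ {x y} → iter f (suc M) x ≈ iter f (suc M) y [ d ] → x ≈ y [ d ]
  cancel {x} {y} p = ≈-trans (≈-sym (weaken (proj₂ period x)))
    (≈-trans p (weaken (proj₂ period y)))

-- The increments f(a + 1) − f(a) at a = 0, 2, 4 agree modulo m, so two of them agree modulo 2m.
ker-4-lift : ∀ {N} .{{_ : NonZero N}} {m f} → + N ≡ + 2 * m → Skew (+ N) f → Skew m f →
             Ker m f (+ 2) → Ker (+ N) f (+ 4)
ker-4-lift {N} {m} {f} N≡2m S S′ K = choose (three-halves {x0} {x2} {x4} x0≈x2 x2≈x4)
  where
  open Skew S′
  open SkewProperties S
  open FiniteSkew S
  x0 x2 x4 : ℤ
  x0 = f (+ 1) - f (+ 0)
  x2 = f (+ 3) - f (+ 2)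
  x4 = f (+ 5) - f (+ 4)
  k3 : f (+ 3) ≈ f (+ 2) + f (+ 1) [ m ]
  k3 = K (+ 1)
  k4 : f (+ 4) ≈ f (+ 2) + f (+ 2) [ m ]
  k4 = K (+ 2)
  k5 : f (+ 5) ≈ f (+ 2) + f (+ 3) [ m ]
  k5 = K (+ 3)
  x0≈x2 : f (+ 1) - f (+ 0) ≈ f (+ 3) - f (+ 2) [ m ]
  x0≈x2 = lin₂ f0 k3 (- + 1) (- + 1)
    (solve 4 (λ a b c d → a :- b :- (c :- d) := Κ -1ℤ :* (b :- Κ 0ℤ) :+ Κ -1ℤ :* (c :- (d :+ a)))
      refl (f (+ 1)) (f (+ 0)) (f (+ 3)) (f (+ 2)))
  x2≈x4 : f (+ 3) - f (+ 2) ≈ f (+ 5) - f (+ 4) [ m ]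
  x2≈x4 = lin₂ k5 k4 (- + 1) (+ 1)
    (solve 4 (λ a b c d → a :- b :- (c :- d) := Κ -1ℤ :* (c :- (b :+ a)) :+ Κ 1ℤ :* (d :- (b :+ b)))
      refl (f (+ 3)) (f (+ 2)) (f (+ 5)) (f (+ 4)))
  choose : x0 ≈ x2 [ + 2 * m ] ⊎ x2 ≈ x4 [ + 2 * m ] ⊎ x0 ≈ x4 [ + 2 * m ] → Ker (+ N) f (+ 4)
  choose h with subst (λ k → x0 ≈ x2 [ k ] ⊎ x2 ≈ x4 [ k ] ⊎ x0 ≈ x4 [ k ]) (sym N≡2m) h
  ... | inj₁ p        = ker-* (+ 2) (equal-increments⇒ker (+ 2) (+ 0) (≈-sym p))
  ... | inj₂ (inj₁ p) = ker-* (+ 2) (equal-increments⇒ker (+ 4) (+ 2) (≈-sym p))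
  ... | inj₂ (inj₂ p) = equal-increments⇒ker (+ 4) (+ 0) (≈-sym p)

-- Arithmetic modulo p, and the kernels modulo p, 2p and 4p.

euclid : ∀ {p} → Prime p → ∀ a b → a * b ≈ + 0 [ + p ] → a ≈ + 0 [ + p ] ⊎ b ≈ + 0 [ + p ]
euclid {p} pr a b ab≈0 with euclidsLemma ∣ a ∣ ∣ b ∣ pr (subst (p ℕ.∣_) (abs-* a b) (∣⇒∣ᵤ (≈⇒∣ ab≈0)))
... | inj₁ p∣a = inj₁ (∣⇒≈ (∣ᵤ⇒∣ p∣a))
... | inj₂ p∣b = inj₂ (∣⇒≈ (∣ᵤ⇒∣ p∣b))

inverse : ∀ {p} → Prime p → ∀ c → ¬ c ≈ + 0 [ + p ] → Σ ℤ λ k → k * c ≈ + 1 [ + p ]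
inverse {p} pr c c≉0 = transfer (coprime-Bézout (prime⇒coprime pr (n%ℕd<d c p)))
  where
  instance
    p≢0 : NonZero p
    p≢0 = prime⇒nonZero pr
  r : ℕ
  r = c %ℕ p
  c≈r : c ≈ + r [ + p ]
  c≈r = residue c p
  instance
    r≢0 : NonZero r
    r≢0 = ℕ.≢-nonZero λ r≡0 → c≉0 (subst (λ i → c ≈ + i [ + p ]) r≡0 c≈r)
  cast : ∀ {u v} x y → 1 ℕ.+ x ℕ.* u ≡ y ℕ.* v → + 1 + + x * + u ≡ + y * + v
  cast {u} {v} x y e = trans (cong (λ z → + 1 + z) (sym (pos-* x u))) (trans (cong +_ e) (pos-* y v))
  transfer : Bézout.Identity 1 p r → Σ ℤ λ k → k * c ≈ + 1 [ + p ]
  transfer (Bézout.+- x y eq) = - + y ,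
    lin₃ c≈r (≡⇒≈ (cast y x eq)) (multiple (+ x)) (- + y) (- + 1) (- + 1)
      (solve 5 (λ a b c d e → (:- a) :* b :- Κ 1ℤ := (:- a) :* (b :- c) :+ Κ -1ℤ :*
        (Κ 1ℤ :+ a :* c :- d :* e) :+ Κ -1ℤ :* (d :* e :- Κ 0ℤ)) refl (+ y) c (+ r) (+ x) (+ p))
  transfer (Bézout.-+ x y eq) = + y ,
    lin₃ c≈r (≡⇒≈ (cast x y eq)) (multiple (+ x)) (+ y) (- + 1) (+ 1)
      (solve 5 (λ a b c d e → a :* b :- Κ 1ℤ := a :* (b :- c) :+ Κ -1ℤ :* (Κ 1ℤ :+ d :* e :- a :* c)
        :+ Κ 1ℤ :* (d :* e :- Κ 0ℤ)) refl (+ y) c (+ r) (+ x) (+ p))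

module OddPrime {p : ℕ} (pr : Prime p) (p≢2 : p ≢ 2) where
  instance
    p≢0 : NonZero p
    p≢0 = prime⇒nonZero pr
    2*p≢0 : NonZero (2 ℕ.* p)
    2*p≢0 = ℕ.m*n≢0 2 p
    4*p≢0 : NonZero (4 ℕ.* p)
    4*p≢0 = ℕ.m*n≢0 4 p

  1<p : 1 ℕ.< p
  1<p = ℕ.nonTrivial⇒n>1 p {{prime⇒nonTrivial pr}}

  2<p : 2 ℕ.< p
  2<p = ℕ.≤∧≢⇒< 1<p (λ e → p≢2 (sym e))

  2≉0 : ¬ + 2 ≈ + 0 [ + p ]
  2≉0 = n≢0⇒≉0 2<p (λ ())

  4≉0 : ¬ + 4 ≈ + 0 [ + p ]
  4≉0 h = [ 2≉0 , 2≉0 ]′ (euclid pr (+ 2) (+ 2) h)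

  -- If k c ≡ 1 modulo p, then e k c ≡ e modulo e p, so e is a multiple of c modulo N.
  ker-cofactor : ∀ {N} .{{_ : NonZero N}} {f c} e → + N ≡ e * + p → Skew (+ N) f →
                 Ker (+ N) f c → ¬ c ≈ + 0 [ + p ] → Ker (+ N) f e
  ker-cofactor {N} {f} {c} e N≡e*p S K c≉0 = finish (inverse pr c c≉0)
    where
    open SkewProperties S
    open FiniteSkew S
    finish : (Σ ℤ λ k → k * c ≈ + 1 [ + p ]) → Ker (+ N) f e
    finish (k , kc≈1) = ker-resp
      (≈-modulus (sym N≡e*p) (lin₁ (scale e kc≈1) (+ 1)
        (solve 3 (λ a b c → a :* b :* c :- a := Κ 1ℤ :* (a :* (b :* c) :- a :* Κ 1ℤ)) refl e k c)
        )) (ker-* (e * k) K)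

  ker-2-mod-p : ∀ {f} → Skew (+ p) f → Ker (+ p) f (+ 2)
  ker-2-mod-p {f} S = finish (ker-nontrivial 1<p S)
    where
    open FiniteSkew S
    finish : (Σ ℤ λ c → Ker (+ p) f c × ¬ c ≈ + 0 [ + p ]) → Ker (+ p) f (+ 2)
    finish (c , K , c≉0) = ker-* (+ 2) (ker-cofactor (+ 1)
      (solve 1 (λ a → a := Κ 1ℤ :* a) refl (+ p)) S K c≉0)

  -- A kernel element prime to p gives 2 at once. Otherwise it is p modulo 2p; then f descends to
  -- ℤ/p, where 2 is in the kernel, and lifting puts 4 into the kernel modulo 2p. As 4 is prime to
  -- p, this again gives 2.
  ker-2-mod-2p : ∀ {f} → Skew (+ (2 ℕ.* p)) f → Ker (+ (2 ℕ.* p)) f (+ 2)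
  ker-2-mod-2p {f} S = finish (ker-nontrivial (ℕ.*-mono-≤ (ℕ.≤-refl {2}) (ℕ.<⇒≤ 1<p)) S)
    where
    open SkewProperties S
    open FiniteSkew S
    from-p : Ker (+ (2 ℕ.* p)) f (+ p) → Ker (+ (2 ℕ.* p)) f (+ 2)
    from-p K = ker-cofactor (+ 2) (pos-* 2 p) S (ker-4-lift (pos-* 2 p) S S′ (ker-2-mod-p S′)) 4≉0
      where
      S′ : Skew (+ p) f
      S′ = skew-quotient (+ 2) (+ p) (pos-* 2 p) S K

    even-or-odd : ∀ {c} → Ker (+ (2 ℕ.* p)) f c → ¬ c ≈ + 0 [ + (2 ℕ.* p) ] → (q : ℤ) → c ≡ q * + p →
                  (Σ ℤ λ t → q ≡ + 2 * t) ⊎ (Σ ℤ λ t → q ≡ + 1 + + 2 * t) → Ker (+ (2 ℕ.* p)) f (+ 2)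
    even-or-odd K c≉0 q refl (inj₁ (t , refl)) =
      contradiction (≈-modulus (sym (pos-* 2 p)) (lin₁ (multiple t) (+ 1)
        (solve 2 (λ a b → Κ (+ 2) :* a :* b :- Κ 0ℤ := Κ 1ℤ :* (a :* (Κ (+ 2) :* b) :- Κ 0ℤ)) refl t
          (+ p)))) c≉0
    even-or-odd K c≉0 q refl (inj₂ (t , refl)) =
      from-p (ker-resp (≈-modulus (sym (pos-* 2 p)) (lin₁ (multiple t) (+ 1)
        (solve 2 (λ a b → (Κ 1ℤ :+ Κ (+ 2) :* a) :* b :- b := Κ 1ℤ :* (a :* (Κ (+ 2) :* b) :- Κ 0ℤ))
          refl t (+ p)))) K)

    finish : (Σ ℤ λ c → Ker (+ (2 ℕ.* p)) f c × ¬ c ≈ + 0 [ + (2 ℕ.* p) ]) → Ker (+ (2 ℕ.* p)) f (+ 2)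
    finish (c , K , c≉0) with c ≈? + 0 [ + p ]
    ... | no  c≉0′ = ker-cofactor (+ 2) (pos-* 2 p) S K c≉0′
    ... | yes c≈0  = let q , c≡qp = exact c≈0 in even-or-odd K c≉0 q c≡qp (parity q)

  4p≡2*2p : + (4 ℕ.* p) ≡ + 2 * + (2 ℕ.* p)
  4p≡2*2p = trans (pos-* 4 p) (trans {j = + 2 * (+ 2 * + p)}
    (solve 1 (λ a → Κ (+ 4) :* a := Κ (+ 2) :* (Κ (+ 2) :* a)) refl (+ p))
    (cong (λ z → + 2 * z) (sym (pos-* 2 p))))

  -- A kernel element divisible by p is p, 2p or 3p modulo 4p, so it or its double is 2p. Then f
  -- descends to ℤ/2p, and 2 in the kernel there lifts to 4.
  ker-4-mod-4p : ∀ {f} → Skew (+ (4 ℕ.* p)) f → Ker (+ (4 ℕ.* p)) f (+ 4)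
  ker-4-mod-4p {f} S = finish (ker-nontrivial (ℕ.*-mono-≤ (ℕ.s≤s (ℕ.s≤s (ℕ.z≤n {2}))) (ℕ.<⇒≤ 1<p)) S)
    where
    open SkewProperties S
    open FiniteSkew S
    from-2p : Ker (+ (4 ℕ.* p)) f (+ (2 ℕ.* p)) → Ker (+ (4 ℕ.* p)) f (+ 4)
    from-2p K = ker-4-lift 4p≡2*2p S S′ (ker-2-mod-2p S′)
      where
      S′ : Skew (+ (2 ℕ.* p)) f
      S′ = skew-quotient (+ 2) (+ (2 ℕ.* p)) 4p≡2*2p S K

    by-remainder : ∀ {c} → Ker (+ (4 ℕ.* p)) f c → ¬ c ≈ + 0 [ + (4 ℕ.* p) ] → (q : ℤ) → c ≡ q * + p →
                   (Σ ℕ λ r → r ℕ.< 4 × Σ ℤ λ t → q ≡ + r + t * + 4) → Ker (+ (4 ℕ.* p)) f (+ 4)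
    by-remainder K c≉0 q refl (0 , _ , t , refl) =
      contradiction (≈-modulus (sym (pos-* 4 p)) (lin₁ (multiple t) (+ 1)
        (solve 2 (λ a b → (Κ 0ℤ :+ a :* Κ (+ 4)) :* b :- Κ 0ℤ := Κ 1ℤ :*
          (a :* (Κ (+ 4) :* b) :- Κ 0ℤ)) refl t (+ p)))) c≉0
    by-remainder K c≉0 q refl (1 , _ , t , refl) = from-2p (ker-resp
      (≈-modulus (sym (pos-* 4 p)) (lin₂ (multiple t) (≡⇒≈ (pos-* 2 p)) (+ 2) (- + 1)
        (solve 3 (λ a b c → Κ (+ 2) :* ((Κ 1ℤ :+ Κ 0ℤ :+ a :* Κ (+ 4)) :* b) :- c := Κ (+ 2) :*
          (a :* (Κ (+ 4) :* b) :- Κ 0ℤ) :+ Κ -1ℤ :* (c :- Κ (+ 2) :* b)) refl t (+ p) (+ (2 ℕ.* p)))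
        )) (ker-* (+ 2) K))
    by-remainder K c≉0 q refl (2 , _ , t , refl) = from-2p (ker-resp
      (≈-modulus (sym (pos-* 4 p)) (lin₂ (multiple t) (≡⇒≈ (pos-* 2 p)) (+ 1) (- + 1)
        (solve 3 (λ a b c → (Κ 1ℤ :+ (Κ 1ℤ :+ Κ 0ℤ) :+ a :* Κ (+ 4)) :* b :- c := Κ 1ℤ :*
          (a :* (Κ (+ 4) :* b) :- Κ 0ℤ) :+ Κ -1ℤ :* (c :- Κ (+ 2) :* b)) refl t (+ p) (+ (2 ℕ.* p))))) K)
    by-remainder K c≉0 q refl (3 , _ , t , refl) = from-2p (ker-resp
      (≈-modulus (sym (pos-* 4 p)) (lin₂ (multiple (+ 2 * t + + 1)) (≡⇒≈ (pos-* 2 p)) (+ 1) (- + 1)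
        (solve 3 (λ a b c → Κ (+ 2) :* ((Κ 1ℤ :+ (Κ 1ℤ :+ (Κ 1ℤ :+ Κ 0ℤ)) :+ a :* Κ (+ 4)) :* b) :-
          c := Κ 1ℤ :* ((Κ (+ 2) :* a :+ Κ 1ℤ) :* (Κ (+ 4) :* b) :- Κ 0ℤ) :+ Κ -1ℤ :*
          (c :- Κ (+ 2) :* b)) refl t (+ p) (+ (2 ℕ.* p))))) (ker-* (+ 2) K))
    by-remainder K c≉0 q refl (suc (suc (suc (suc _))) , ℕ.s≤s (ℕ.s≤s (ℕ.s≤s (ℕ.s≤s ()))) , _)

    finish : (Σ ℤ λ c → Ker (+ (4 ℕ.* p)) f c × ¬ c ≈ + 0 [ + (4 ℕ.* p) ]) → Ker (+ (4 ℕ.* p)) f (+ 4)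
    finish (c , K , c≉0) with c ≈? + 0 [ + p ]
    ... | no  c≉0′ = ker-cofactor (+ 4) (pos-* 4 p) S K c≉0′
    ... | yes c≈0  = let q , c≡qp = exact c≈0 in by-remainder K c≉0 q c≡qp (division q 4)

-- Iterates of maps that are affine on the classes modulo 4.

geometric : ℤ → ℕ → ℤ
geometric v zero    = + 0
geometric v (suc k) = + 1 + v * geometric v k

module AffineOnClasses {m v : ℤ} {h : ℤ → ℤ} (fixed : ∀ x → h x ≈ x [ + 4 ])
       (slope : ∀ {x y} → x ≈ y [ + 4 ] → h x ≈ h y + v * (x - y) [ m ]) where

  iter-fixed : ∀ k x → iter h k x ≈ x [ + 4 ]
  iter-fixed zero    x = ≈-refl
  iter-fixed (suc k) x = ≈-trans (fixed (iter h k x)) (iter-fixed k x)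

  -- All iterates stay in the class of x, where h has slope v. Hence h^(k+1)(x) - h(x) = v (h^k(x) -
  -- x), which is the recursion of the geometric sum.
  iter-affine : ∀ k x → iter h k x ≈ x + geometric v k * (h x - x) [ m ]
  iter-affine zero    x = ≡⇒≈ {x} {x + + 0 * (h x - x)}
    (solve 2 (λ a b → a := a :+ Κ 0ℤ :* (b :- a)) refl x (h x))
  iter-affine (suc k) x = lin₂ {h (iter h k x)} {x + (+ 1 + v * geometric v k) * (h x - x)}
    (slope (iter-fixed k x)) (iter-affine k x) (+ 1) v
      (solve 6 (λ a b c d e g → a :- (b :+ (Κ 1ℤ :+ c :* d) :* (e :- b)) := Κ 1ℤ :*
        (a :- (e :+ c :* (g :- b))) :+ c :* (g :- (b :+ d :* (e :- b)))) refl (h (iter h k x)) x v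
        (geometric v k) (h x) (iter h k x))

iter-double : ∀ f k x → iter f (k ℕ.+ k) x ≡ iter (λ y → f (f y)) k x
iter-double f zero    x = refl
iter-double f (suc k) x =
  cong f (trans (cong (λ i → iter f i x) (ℕ.+-suc k k)) (cong f (iter-double f k x)))

halve : ∀ k → Σ ℕ λ e → k ≡ e ℕ.+ e ⊎ k ≡ suc (e ℕ.+ e)
halve zero = 0 , inj₁ refl
halve (suc k) with halve k
... | e , inj₁ refl = e , inj₂ refl
... | e , inj₂ refl = suc e , inj₁ (cong suc (sym (ℕ.+-suc e e)))

-- Together with 4 in the kernel these values fix every even residue and shift every odd one by f(1)
-- - 1.
ByParity : ℤ → (ℤ → ℤ) → Set
ByParity m f = f (+ 4) ≈ + 4 [ m ] × f (+ 2) ≈ + 2 [ m ] × f (+ 3) ≈ f (+ 1) + + 2 [ m ]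

-- The shifts at 1, 2, 3 are s, s(1 + ω), sω with s = f(1) - 1. The last is s(1 + ω + ω²) modulo 4p,
-- since 4 divides s and ω² ≡ -1 modulo p.
ByFourthRoot : ℕ → ℤ → (ℤ → ℤ) → Set
ByFourthRoot p m f = f (+ 4) ≈ + 4 [ m ] × Σ ℕ λ ω → + ω * + ω + + 1 ≈ + 0 [ + p ] ×
  f (+ 1) ≈ + 1 [ + 4 ] ×
  f (+ 2) ≈ + 2 + (f (+ 1) - + 1) * (+ ω + + 1) [ m ] ×
  f (+ 3) ≈ + 3 + (f (+ 1) - + 1) * + ω [ m ]

-- Skew morphisms modulo 4p, classified by a few values.

module Classification {p : ℕ} (pr : Prime p) (p≢2 : p ≢ 2) {f : ℤ → ℤ} (S : Skew (+ (4 ℕ.* p)) f) where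
  open OddPrime pr p≢2
  open Skew S
  open SkewProperties S
  open FiniteSkew S

  m : ℤ
  m = + (4 ℕ.* p)

  K : Ker m f (+ 4)
  K = ker-4-mod-4p S

  -- A multiple x of 4 makes `k * x` modulo 4p depend only on k modulo p.
  vanish : ∀ {k x} → k ≈ + 0 [ + p ] → x ≈ + 0 [ + 4 ] → k * x ≈ + 0 [ m ]
  vanish {k} {x} k≈0 x≈0 = go (exact x≈0)
    where
    go : (Σ ℤ λ q → x ≡ q * + 4) → k * x ≈ + 0 [ m ]
    go (q , refl) = ≈-modulus (sym (pos-* 4 p)) (lin₁ (scale (+ 4) k≈0) q
      (solve 2 (λ a b → a :* (b :* Κ (+ 4)) :- Κ 0ℤ := b :* (Κ (+ 4) :* a :- Κ (+ 4) :* Κ 0ℤ)) refl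
        k q))

  -- After division by 4 this is Euclid's lemma modulo p; it is what turns identities modulo 4p into
  -- case distinctions.
  divide : ∀ {k x} → x ≈ + 0 [ + 4 ] → k * x ≈ + 0 [ m ] → k ≈ + 0 [ + p ] ⊎ x ≈ + 0 [ m ]
  divide {k} {x} x≈0 kx≈0 = go (exact x≈0) kx≈0
    where
    go : ∀ {x} → (Σ ℤ λ q → x ≡ q * + 4) → k * x ≈ + 0 [ m ] → k ≈ + 0 [ + p ] ⊎ x ≈ + 0 [ m ]
    go (q , refl) kx≈0 = [ inj₁ ,
      (λ q≈0 → inj₂ (≈-modulus (sym (pos-* 4 p)) (lin₁ (scale (+ 4) q≈0) (+ 1)
        (solve 1 (λ a → a :* Κ (+ 4) :- Κ 0ℤ := Κ 1ℤ :* (Κ (+ 4) :* a :- Κ (+ 4) :* Κ 0ℤ)) refl q)))) ]′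
      (euclid pr k q (unscale (+ 4) (lin₁ (≈-modulus (pos-* 4 p) kx≈0) (+ 1)
        (solve 2 (λ a b → Κ (+ 4) :* (a :* b) :- Κ (+ 4) :* Κ 0ℤ := Κ 1ℤ :*
          (a :* (b :* Κ (+ 4)) :- Κ 0ℤ)) refl k q))))

  half : ∀ {x y} → x ≈ y [ + 4 ] → + 2 * x ≈ + 2 * y [ m ] → x ≈ y [ m ]
  half {x} {y} x≈y 2x≈2y =
    [ (λ 2≈0 → contradiction 2≈0 2≉0) , (λ x-y≈0 → lin₁ x-y≈0 (+ 1)
      (solve 2 (λ a b → a :- b := Κ 1ℤ :* (a :- b :- Κ 0ℤ)) refl x y)) ]′
    (divide {+ 2} {x - y} (lin₁ x≈y (+ 1)
      (solve 2 (λ a b → a :- b :- Κ 0ℤ := Κ 1ℤ :* (a :- b)) refl x y)) (lin₁ 2x≈2y (+ 1)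
      (solve 2 (λ a b → Κ (+ 2) :* (a :- b) :- Κ 0ℤ := Κ 1ℤ :* (Κ (+ 2) :* a :- Κ (+ 2) :* b)) refl
        x y)))

  S₄ : Skew (+ 4) f
  S₄ = skew-quotient (+ p) (+ 4) (trans (pos-* 4 p)
    (solve 1 (λ a → Κ (+ 4) :* a := a :* Κ (+ 4)) refl (+ p))) S K

  module Modulo4 where
    open Skew S₄ using () renaming (resp to resp₄; inj to inj₄; f0 to f0₄)
    open FiniteSkew S₄ using () renaming (ker-* to ker-*₄)
    open SkewProperties S₄ using () renaming (ker-resp to ker-resp₄)

    ¬1 : ¬ + 1 ≈ + 0 [ + 4 ]
    ¬1 = n≢0⇒≉0 (ℕ.s≤s (ℕ.s≤s ℕ.z≤n)) λ ()
    ¬2 : ¬ + 2 ≈ + 0 [ + 4 ]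
    ¬2 = n≢0⇒≉0 (ℕ.s≤s (ℕ.s≤s (ℕ.s≤s ℕ.z≤n))) λ ()

    4≈0 : + 4 ≈ + 0 [ + 4 ]
    4≈0 = multiple (+ 1)

    remainder : ∀ x → x ≈ + 0 [ + 4 ] ⊎ x ≈ + 1 [ + 4 ] ⊎ x ≈ + 2 [ + 4 ] ⊎ x ≈ + 3 [ + 4 ]
    remainder x = go (division x 4)
      where
      go : (Σ ℕ λ r → r ℕ.< 4 × Σ ℤ λ t → x ≡ + r + t * + 4) → _
      go (0 , _ , t , refl) = inj₁ (lin₁ (multiple t) (+ 1)
        (solve 1 (λ a → Κ 0ℤ :+ a :* Κ (+ 4) :- Κ 0ℤ := Κ 1ℤ :* (a :* Κ (+ 4) :- Κ 0ℤ)) refl t))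
      go (1 , _ , t , refl) = inj₂ (inj₁ (lin₁ (multiple t) (+ 1)
        (solve 1 (λ a → Κ 1ℤ :+ Κ 0ℤ :+ a :* Κ (+ 4) :- Κ 1ℤ := Κ 1ℤ :* (a :* Κ (+ 4) :- Κ 0ℤ)) refl
          t)))
      go (2 , _ , t , refl) = inj₂ (inj₂ (inj₁ (lin₁ (multiple t) (+ 1)
        (solve 1 (λ a → Κ 1ℤ :+ (Κ 1ℤ :+ Κ 0ℤ) :+ a :* Κ (+ 4) :- Κ (+ 2) := Κ 1ℤ :*
          (a :* Κ (+ 4) :- Κ 0ℤ)) refl t))))
      go (3 , _ , t , refl) = inj₂ (inj₂ (inj₂ (lin₁ (multiple t) (+ 1)
        (solve 1 (λ a → Κ 1ℤ :+ (Κ 1ℤ :+ (Κ 1ℤ :+ Κ 0ℤ)) :+ a :* Κ (+ 4) :- Κ (+ 3) := Κ 1ℤ :*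
          (a :* Κ (+ 4) :- Κ 0ℤ)) refl t))))
      go (suc (suc (suc (suc _))) , ℕ.s≤s (ℕ.s≤s (ℕ.s≤s (ℕ.s≤s ()))) , _)

    -- Each nonzero residue modulo 4 has 2 as a multiple.
    K₂ : Ker (+ 4) f (+ 2)
    K₂ = go (ker-nontrivial (ℕ.s≤s (ℕ.s≤s ℕ.z≤n)) S₄)
      where
      go : (Σ ℤ λ c → Ker (+ 4) f c × ¬ c ≈ + 0 [ + 4 ]) → Ker (+ 4) f (+ 2)
      go (c , Kc , c≉0) with remainder c
      ... | inj₁ c≈0               = contradiction c≈0 c≉0
      ... | inj₂ (inj₁ c≈1)        = ker-resp₄ (*-monoʳ (+ 2) c≈1) (ker-*₄ (+ 2) Kc)
      ... | inj₂ (inj₂ (inj₁ c≈2)) = ker-resp₄ c≈2 Kc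
      ... | inj₂ (inj₂ (inj₂ c≈3)) = ker-resp₄ (lin₂ c≈3 4≈0 (+ 2) (+ 1)
        (solve 1 (λ a → Κ (+ 2) :* a :- Κ (+ 2) := Κ (+ 2) :* (a :- Κ (+ 3)) :+ Κ 1ℤ :*
          (Κ (+ 4) :- Κ 0ℤ)) refl c)) (ker-*₄ (+ 2) Kc)

    2f2≈0 : + 2 * f (+ 2) ≈ + 0 [ + 4 ]
    2f2≈0 = lin₃ K₂-2 (resp₄ 4≈0) f0₄ (- + 1) (+ 1) (+ 1)
      (solve 3 (λ a b c → Κ (+ 2) :* a :- Κ 0ℤ := Κ -1ℤ :* (b :- (a :+ a)) :+ Κ 1ℤ :* (b :- c) :+ Κ
        1ℤ :* (c :- Κ 0ℤ)) refl (f (+ 2)) (f (+ 4)) (f (+ 0)))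
      where
      K₂-2 : f (+ 4) ≈ f (+ 2) + f (+ 2) [ + 4 ]
      K₂-2 = K₂ (+ 2)

    -- 2 f(2) = f(4) = 0 makes f(2) even, and injectivity excludes 0.
    f2≈2 : f (+ 2) ≈ + 2 [ + 4 ]
    f2≈2 with remainder (f (+ 2))
    ... | inj₁ h               = contradiction (inj₄ (≈-trans h (≈-sym f0₄))) ¬2
    ... | inj₂ (inj₁ h)        = contradiction (lin₂ 2f2≈0 h (+ 1) (- + 2)
      (solve 1 (λ a → Κ (+ 2) :- Κ 0ℤ := Κ 1ℤ :* (Κ (+ 2) :* a :- Κ 0ℤ) :+ (:- Κ (+ 2)) :*
        (a :- Κ 1ℤ)) refl (f (+ 2)))) ¬2
    ... | inj₂ (inj₂ (inj₁ h)) = h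
    ... | inj₂ (inj₂ (inj₂ h)) = contradiction (lin₃ 2f2≈0 h 4≈0 (+ 1) (- + 2) (- + 1)
      (solve 1 (λ a → Κ (+ 2) :- Κ 0ℤ := Κ 1ℤ :* (Κ (+ 2) :* a :- Κ 0ℤ) :+ (:- Κ (+ 2)) :*
        (a :- Κ (+ 3)) :+ Κ -1ℤ :* (Κ (+ 4) :- Κ 0ℤ)) refl (f (+ 2)))) ¬2

    f3≈2+f1 : f (+ 3) ≈ + 2 + f (+ 1) [ + 4 ]
    f3≈2+f1 = ≈-trans (K₂ (+ 1)) (+-mono f2≈2 ≈-refl)

    four-values : ∀ {g : ℤ → ℤ} → (∀ {x y} → x ≈ y [ + 4 ] → g x ≈ g y [ + 4 ]) →
                  f (+ 0) ≈ g (+ 0) [ + 4 ] → f (+ 1) ≈ g (+ 1) [ + 4 ] →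
                  f (+ 2) ≈ g (+ 2) [ + 4 ] → f (+ 3) ≈ g (+ 3) [ + 4 ] →
                  ∀ x → f x ≈ g x [ + 4 ]
    four-values g-resp h0 h1 h2 h3 x with remainder x
    ... | inj₁ h               = ≈-trans (resp₄ h) (≈-trans h0 (≈-sym (g-resp h)))
    ... | inj₂ (inj₁ h)        = ≈-trans (resp₄ h) (≈-trans h1 (≈-sym (g-resp h)))
    ... | inj₂ (inj₂ (inj₁ h)) = ≈-trans (resp₄ h) (≈-trans h2 (≈-sym (g-resp h)))
    ... | inj₂ (inj₂ (inj₂ h)) = ≈-trans (resp₄ h) (≈-trans h3 (≈-sym (g-resp h)))

    -- The values 0 and 2 are taken at 0 and 2, so injectivity leaves only ±1 for f(1).
    sign : (∀ x → f x ≈ x [ + 4 ]) ⊎ (∀ x → f x ≈ - x [ + 4 ])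
    sign with remainder (f (+ 1))
    ... | inj₁ h               = contradiction (inj₄ (≈-trans h (≈-sym f0₄))) ¬1
    ... | inj₂ (inj₁ h)        = inj₁ (four-values (λ p → p) f0₄ h f2≈2 (lin₂ f3≈2+f1 h (+ 1) (+ 1)
      (solve 2 (λ a b → a :- Κ (+ 3) := Κ 1ℤ :* (a :- (Κ (+ 2) :+ b)) :+ Κ 1ℤ :* (b :- Κ 1ℤ)) refl
        (f (+ 3)) (f (+ 1)))))
    ... | inj₂ (inj₂ (inj₁ h)) = contradiction
      (lin₁ (inj₄ {+ 2} {+ 1} (≈-trans f2≈2 (≈-sym h))) (+ 1)
        (solve 0 (Κ 1ℤ :- Κ 0ℤ := Κ 1ℤ :* (Κ (+ 2) :- Κ 1ℤ)) refl)) ¬1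
    ... | inj₂ (inj₂ (inj₂ h)) = inj₂ (four-values (λ {x} {y} p → lin₁ p (- + 1)
      (solve 2 (λ a b → :- a :- :- b := Κ -1ℤ :* (a :- b)) refl x y)) f0₄
      (lin₂ h 4≈0 (+ 1) (+ 1)
        (solve 1 (λ a → a :- Κ -1ℤ := Κ 1ℤ :* (a :- Κ (+ 3)) :+ Κ 1ℤ :* (Κ (+ 4) :- Κ 0ℤ)) refl
          (f (+ 1)))) (lin₂ f2≈2 4≈0 (+ 1) (+ 1)
        (solve 1 (λ a → a :- :- Κ (+ 2) := Κ 1ℤ :* (a :- Κ (+ 2)) :+ Κ 1ℤ :* (Κ (+ 4) :- Κ 0ℤ)) refl
          (f (+ 2))))
      (lin₃ f3≈2+f1 h 4≈0 (+ 1) (+ 1) (+ 2)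
        (solve 2 (λ a b → a :- :- Κ (+ 3) := Κ 1ℤ :* (a :- (Κ (+ 2) :+ b)) :+ Κ 1ℤ :* (b :- Κ (+ 3))
          :+ Κ (+ 2) :* (Κ (+ 4) :- Κ 0ℤ)) refl (f (+ 3)) (f (+ 1)))))

    f4≈0 : f (+ 4) ≈ + 0 [ + 4 ]
    f4≈0 = ≈-trans (resp₄ 4≈0) f0₄

  open Modulo4 using (sign; f4≈0; ¬2)

  opaque
    -- The common slope f(4) / 4 of f on the classes modulo 4.
    u : ℤ
    u = _∣_.quotient (≈⇒∣ f4≈0)

    f4≡u4 : f (+ 4) ≡ u * + 4
    f4≡u4 = _∣_.equality (≈⇒∣ f4≈0)

  slope : ∀ {x y} → x ≈ y [ + 4 ] → f x ≈ f y + u * (x - y) [ m ]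
  slope {x} {y} (mk (divides t e)) =
    lin₄ (resp-≡ (move e)) (ker-* t K y) (value-* t K)
         (lin₂ {x = t * f (+ 4)} {u * (x - y)} (≡⇒≈ f4≡u4) (≡⇒≈ e) t (- u)
           (solve 5 (λ a b c d e → a :* b :- c :* (d :- e) := a :* (b :- c :* Κ (+ 4)) :+ (:- c) :*
             (d :- e :- a :* Κ (+ 4))) refl t (f (+ 4)) u x y))
         (+ 1) (+ 1) (+ 1) (+ 1)
           (solve 9 (λ a b c d e g h i j → a :- (b :+ c :* (d :- e)) := Κ 1ℤ :* (a :- g) :+ Κ 1ℤ :*
             (g :- (h :+ b)) :+ Κ 1ℤ :* (h :- i :* j) :+ Κ 1ℤ :* (i :* j :- c :* (d :- e))) refl
             (f x) (f y) u x y (f (t * + 4 + y)) (f (t * + 4)) t (f (+ 4)))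
    where
    move : ∀ {s} → x - y ≡ s → x ≡ s + y
    move refl = solve 2 (λ a b → a := a :- b :+ b) refl x y

  Outcome : Set
  Outcome = Ker m f (+ 1) ⊎ ByParity m f ⊎ ByFourthRoot p m f

  -- Here f^k(l) = l + w (f(l) - l) with w depending only on k, so the power attached to j enters
  -- through the single number `w j`.
  module Positive (fixed : ∀ x → f x ≈ x [ + 4 ]) (w : ℤ → ℤ)
         (expand : ∀ j l → f (j + l) ≈ f j + l + w j * (f l - l) [ m ]) where

    f-x≈0 : ∀ x → f x - x ≈ + 0 [ + 4 ]
    f-x≈0 x = lin₁ (fixed x) (+ 1)
      (solve 2 (λ a b → a :- b :- Κ 0ℤ := Κ 1ℤ :* (a :- b)) refl (f x) x)

    e14 : f (+ 5) ≈ f (+ 1) + + 4 + w (+ 1) * (f (+ 4) - + 4) [ m ]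
    e14 = expand (+ 1) (+ 4)
    k41 : f (+ 5) ≈ f (+ 4) + f (+ 1) [ m ]
    k41 = K (+ 1)

    additive : w (+ 1) - + 1 ≈ + 0 [ + p ] → Ker m f (+ 1)
    additive w≈1 y = lin₂ (expand (+ 1) y) (vanish w≈1 (f-x≈0 y)) (+ 1) (+ 1)
      (solve 5 (λ a b c d e → a :- (b :+ c) := Κ 1ℤ :* (a :- (b :+ d :+ e :* (c :- d))) :+ Κ 1ℤ :*
        ((e :- Κ 1ℤ) :* (c :- d) :- Κ 0ℤ)) refl (f (+ 1 + y)) (f (+ 1)) (f y) y (w (+ 1)))

    module Periodic (f4≈4 : f (+ 4) ≈ + 4 [ m ]) where
      e2 : f (+ 2) ≈ f (+ 1) + + 1 + w (+ 1) * (f (+ 1) - + 1) [ m ]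
      e2 = expand (+ 1) (+ 1)
      e3 : f (+ 3) ≈ f (+ 1) + + 2 + w (+ 1) * (f (+ 2) - + 2) [ m ]
      e3 = expand (+ 1) (+ 2)
      e4 : f (+ 4) ≈ f (+ 1) + + 3 + w (+ 1) * (f (+ 3) - + 3) [ m ]
      e4 = expand (+ 1) (+ 3)

      -- The increment f(4) − 4 is (1 + w + w² + w³)(f(1) − 1).
      closing : ((+ 1 + w (+ 1)) * (+ 1 + w (+ 1) * w (+ 1))) * (f (+ 1) - + 1) ≈ + 0 [ m ]
      closing = lin₄ f4≈4 e4 e3 e2 (+ 1) (- + 1) (- w (+ 1)) (- (w (+ 1) * w (+ 1)))
        (solve 5 (λ a b c d e → (Κ 1ℤ :+ a) :* (Κ 1ℤ :+ a :* a) :* (b :- Κ 1ℤ) :- Κ 0ℤ := Κ 1ℤ :*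
          (c :- Κ (+ 4)) :+ Κ -1ℤ :* (c :- (b :+ Κ (+ 3) :+ a :* (d :- Κ (+ 3)))) :+ (:- a) :*
          (d :- (b :+ Κ (+ 2) :+ a :* (e :- Κ (+ 2)))) :+ (:- (a :* a)) :*
          (e :- (b :+ Κ 1ℤ :+ a :* (b :- Κ 1ℤ)))) refl (w (+ 1)) (f (+ 1)) (f (+ 4)) (f (+ 3))
          (f (+ 2)))

      parity-type : (+ 1 + w (+ 1)) * (f (+ 1) - + 1) ≈ + 0 [ m ] → ByParity m f
      parity-type z = f4≈4 , f2≈2 , lin₂ e3 f2≈2 (+ 1) (w (+ 1))
        (solve 4 (λ a b c d → a :- (b :+ Κ (+ 2)) := Κ 1ℤ :*
          (a :- (b :+ Κ (+ 2) :+ c :* (d :- Κ (+ 2)))) :+ c :* (d :- Κ (+ 2))) refl (f (+ 3))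
          (f (+ 1)) (w (+ 1)) (f (+ 2)))
        where
        f2≈2 : f (+ 2) ≈ + 2 [ m ]
        f2≈2 = lin₂ e2 z (+ 1) (+ 1)
          (solve 3 (λ a b c → a :- Κ (+ 2) := Κ 1ℤ :* (a :- (b :+ Κ 1ℤ :+ c :* (b :- Κ 1ℤ))) :+ Κ 1ℤ
            :* ((Κ 1ℤ :+ c) :* (b :- Κ 1ℤ) :- Κ 0ℤ)) refl (f (+ 2)) (f (+ 1)) (w (+ 1)))

      -- The expansion of f(3) has coefficient 1 + w + w² ≡ w modulo p. Replacing w by its residue ω
      -- changes nothing modulo 4p, because f(1) - 1 is a multiple of 4.
      fourth-root-type : + 1 + w (+ 1) * w (+ 1) ≈ + 0 [ + p ] → ByFourthRoot p m f
      fourth-root-type w²≈-1 = build (w (+ 1) %ℕ p) (residue (w (+ 1)) p)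
        where
        build : ∀ ω → w (+ 1) ≈ + ω [ + p ] → ByFourthRoot p m f
        build ω w≈ω = f4≈4 , ω , lin₂ w²≈-1 w≈ω (+ 1) (- (w (+ 1) + + ω))
          (solve 2 (λ a b → a :* a :+ Κ 1ℤ :- Κ 0ℤ := Κ 1ℤ :* (Κ 1ℤ :+ b :* b :- Κ 0ℤ) :+
            (:- (b :+ a)) :* (b :- a)) refl (+ ω) (w (+ 1))) , fixed (+ 1)
          , lin₂ e2 shift (+ 1) (+ 1)
            (solve 4 (λ a b c d → a :- (Κ (+ 2) :+ (b :- Κ 1ℤ) :* (c :+ Κ 1ℤ)) := Κ 1ℤ :*
              (a :- (b :+ Κ 1ℤ :+ d :* (b :- Κ 1ℤ))) :+ Κ 1ℤ :* ((d :- c) :* (b :- Κ 1ℤ) :- Κ 0ℤ))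
              refl (f (+ 2)) (f (+ 1)) (+ ω) (w (+ 1)))
          , lin₄ e3 e2 shift (vanish w²≈-1 (f-x≈0 (+ 1))) (+ 1) (w (+ 1)) (+ 1) (+ 1)
            (solve 5 (λ a b c d e → a :- (Κ (+ 3) :+ (b :- Κ 1ℤ) :* c) := Κ 1ℤ :*
              (a :- (b :+ Κ (+ 2) :+ d :* (e :- Κ (+ 2)))) :+ d :*
              (e :- (b :+ Κ 1ℤ :+ d :* (b :- Κ 1ℤ))) :+ Κ 1ℤ :* ((d :- c) :* (b :- Κ 1ℤ) :- Κ 0ℤ) :+
              Κ 1ℤ :* ((Κ 1ℤ :+ d :* d) :* (b :- Κ 1ℤ) :- Κ 0ℤ)) refl (f (+ 3)) (f (+ 1)) (+ ω)
              (w (+ 1)) (f (+ 2)))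
          where
          shift : (w (+ 1) - + ω) * (f (+ 1) - + 1) ≈ + 0 [ m ]
          shift = vanish {w (+ 1) - + ω} {f (+ 1) - + 1} (lin₁ w≈ω (+ 1)
            (solve 2 (λ a b → a :- b :- Κ 0ℤ := Κ 1ℤ :* (a :- b)) refl (w (+ 1)) (+ ω))
            ) (f-x≈0 (+ 1))

      outcome : Outcome
      outcome = [
          (λ product≈0 → [
              (λ w≈-1 → inj₂ (inj₁ (parity-type (vanish w≈-1 (f-x≈0 (+ 1))))))
            , (λ w²≈-1 → inj₂ (inj₂ (fourth-root-type w²≈-1))) ]′
            (euclid pr (+ 1 + w (+ 1)) (+ 1 + w (+ 1) * w (+ 1)) product≈0))
        -- With f(1) = 1 the map is the identity. It is filed under the parity type and discarded
        -- later as an automorphism.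
        , (λ s≈0 → inj₂ (inj₁ (parity-type (lin₁ s≈0 (+ 1 + w (+ 1))
          (solve 2 (λ a b → (Κ 1ℤ :+ a) :* (b :- Κ 1ℤ) :- Κ 0ℤ := (Κ 1ℤ :+ a) :*
            (b :- Κ 1ℤ :- Κ 0ℤ)) refl (w (+ 1)) (f (+ 1))))))) ]′
        (divide {(+ 1 + w (+ 1)) * (+ 1 + w (+ 1) * w (+ 1))} {f (+ 1) - + 1} (f-x≈0 (+ 1)) closing)

    -- Computing f(5) as f(1 + 4) and as f(4 + 1) gives (w - 1)(f(4) - 4) ≡ 0 modulo 4p with w =
    -- `w (+ 1)`. Either f is additive or f(4) = 4.
    outcome : Outcome
    outcome = [ (λ w≈1 → inj₁ (additive w≈1)) , (λ h → Periodic.outcome (lin₁ h (+ 1)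
      (solve 1 (λ a → a :- Κ (+ 4) := Κ 1ℤ :* (a :- Κ (+ 4) :- Κ 0ℤ)) refl (f (+ 4))))) ]′
      (divide {w (+ 1) - + 1} {f (+ 4) - + 4} (f-x≈0 (+ 4)) (lin₂ e14 k41 (- + 1) (+ 1)
        (solve 4 (λ a b c d → (a :- Κ 1ℤ) :* (b :- Κ (+ 4)) :- Κ 0ℤ := Κ -1ℤ :*
          (c :- (d :+ Κ (+ 4) :+ a :* (b :- Κ (+ 4)))) :+ Κ 1ℤ :* (c :- (b :+ d))) refl (w (+ 1))
          (f (+ 4)) (f (+ 5)) (f (+ 1)))))

  -- f moves classes modulo 4, but f ∘ f preserves them and is affine there with slope u². The
  -- powers attached to elements are odd, so each differs from f by a multiple `r j` of the defect
  -- f(f(l)) - l.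
  module Negative (negative : ∀ x → f x ≈ - x [ + 4 ]) (r : ℤ → ℤ)
         (expand : ∀ j l → f (j + l) ≈ f j + f l + r j * (f (f l) - l) [ m ]) where

    defect≈0 : ∀ x → f (f x) - x ≈ + 0 [ + 4 ]
    defect≈0 x = lin₂ (negative (f x)) (negative x) (+ 1) (- + 1)
      (solve 3 (λ a b c → a :- b :- Κ 0ℤ := Κ 1ℤ :* (a :- :- c) :+ Κ -1ℤ :* (c :- :- b)) refl
        (f (f x)) x (f x))

    e14 : f (+ 5) ≈ f (+ 1) + f (+ 4) + r (+ 1) * (f (f (+ 4)) - + 4) [ m ]
    e14 = expand (+ 1) (+ 4)
    k41 : f (+ 5) ≈ f (+ 4) + f (+ 1) [ m ]
    k41 = K (+ 1)

    additive : r (+ 1) ≈ + 0 [ + p ] → Ker m f (+ 1)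
    additive r≈0 y = lin₂ (expand (+ 1) y) (vanish r≈0 (defect≈0 y)) (+ 1) (+ 1)
      (solve 6 (λ a b c d e g → a :- (b :+ c) := Κ 1ℤ :* (a :- (b :+ c :+ d :* (e :- g))) :+ Κ 1ℤ :*
        (d :* (e :- g) :- Κ 0ℤ)) refl (f (+ 1 + y)) (f (+ 1)) (f y) (r (+ 1)) (f (f y)) y)

    -- Exchanging the summands of 1 + y puts 1 second, so that `r y` is multiplied by the vanishing
    -- defect at 1.
    additive′ : f (f (+ 1)) - + 1 ≈ + 0 [ m ] → Ker m f (+ 1)
    additive′ G1≈0 y = lin₃ (resp-≡ {+ 1 + y} {y + + 1}
      (solve 1 (λ a → Κ 1ℤ :+ a := a :+ Κ 1ℤ) refl y)) (expand y (+ 1)) G1≈0 (+ 1) (+ 1) (r y)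
      (solve 6 (λ a b c d e g → a :- (b :+ c) := Κ 1ℤ :* (a :- d) :+ Κ 1ℤ :*
        (d :- (c :+ b :+ e :* (g :- Κ 1ℤ))) :+ e :* (g :- Κ 1ℤ :- Κ 0ℤ)) refl (f (+ 1 + y))
        (f (+ 1)) (f y) (f (y + + 1)) (r y) (f (f (+ 1))))

    e11 : f (+ 2) ≈ f (+ 1) + f (+ 1) + r (+ 1) * (f (f (+ 1)) - + 1) [ m ]
    e11 = expand (+ 1) (+ 1)
    e13 : f (+ 4) ≈ f (+ 1) + f (+ 3) + r (+ 1) * (f (f (+ 3)) - + 3) [ m ]
    e13 = expand (+ 1) (+ 3)
    e31 : f (+ 4) ≈ f (+ 3) + f (+ 1) + r (+ 3) * (f (f (+ 1)) - + 1) [ m ]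
    e31 = expand (+ 3) (+ 1)
    e33 : f (+ 6) ≈ f (+ 3) + f (+ 3) + r (+ 3) * (f (f (+ 3)) - + 3) [ m ]
    e33 = expand (+ 3) (+ 3)
    k42 : f (+ 6) ≈ f (+ 4) + f (+ 2) [ m ]
    k42 = K (+ 2)

    4≈0 : + 4 ≈ + 0 [ + 4 ]
    4≈0 = multiple (+ 1)

    f1≈3 : f (+ 1) ≈ + 3 [ + 4 ]
    f1≈3 = lin₂ (negative (+ 1)) 4≈0 (+ 1) (- + 1)
      (solve 1 (λ a → a :- Κ (+ 3) := Κ 1ℤ :* (a :- Κ -1ℤ) :+ Κ -1ℤ :* (Κ (+ 4) :- Κ 0ℤ)) refl
        (f (+ 1)))
    f3≈1 : f (+ 3) ≈ + 1 [ + 4 ]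
    f3≈1 = lin₂ (negative (+ 3)) 4≈0 (+ 1) (- + 1)
      (solve 1 (λ a → a :- Κ 1ℤ := Κ 1ℤ :* (a :- :- Κ (+ 3)) :+ Κ -1ℤ :* (Κ (+ 4) :- Κ 0ℤ)) refl
        (f (+ 3)))

    slope-by : ∀ c → u - c ≈ + 0 [ + p ] → ∀ {x y} → x ≈ y [ + 4 ] → f x ≈ f y + c * (x - y) [ m ]
    slope-by c u≈c {x} {y} x≈y =
      lin₂ (slope x≈y) (vanish {u - c} {x - y} u≈c (lin₁ x≈y (+ 1)
        (solve 2 (λ a b → a :- b :- Κ 0ℤ := Κ 1ℤ :* (a :- b)) refl x y))) (+ 1) (+ 1)
        (solve 6 (λ a b c d e g → a :- (b :+ c :* (d :- e)) := Κ 1ℤ :* (a :- (b :+ g :* (d :- e)))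
          :+ Κ 1ℤ :* ((g :- c) :* (d :- e) :- Κ 0ℤ)) refl (f x) (f y) c x y u)

    f4-by : ∀ c → u - c ≈ + 0 [ + p ] → f (+ 4) ≈ c * + 4 [ m ]
    f4-by c u≈c = lin₂ (slope-by c u≈c 4≈0) f0 (+ 1) (+ 1)
      (solve 3 (λ a b c → a :- b :* Κ (+ 4) := Κ 1ℤ :* (a :- (c :+ b :* (Κ (+ 4) :- Κ 0ℤ))) :+ Κ 1ℤ
        :* (c :- Κ 0ℤ)) refl (f (+ 4)) c (f (+ 0)))

    -- For u ≡ 1 the defects at 1 and 3 coincide, so r cancels from f(4) - f(2) and from f(6) -
    -- f(4), and both equal f(3) - f(1). With f(6) = f(4) + f(2) this gives 2 f(2) = f(4) = 4.
    parity-type : u - + 1 ≈ + 0 [ + p ] → ByParity m f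
    parity-type u≈1 = f4 , f2 , lin₃ D f4 f2 (- + 1) (+ 1) (- + 1)
      (solve 4 (λ a b c d → a :- (b :+ Κ (+ 2)) := Κ -1ℤ :* (c :- d :- (a :- b)) :+ Κ 1ℤ :*
        (c :- Κ (+ 4)) :+ Κ -1ℤ :* (d :- Κ (+ 2))) refl (f (+ 3)) (f (+ 1)) (f (+ 4)) (f (+ 2)))
      where
      f4 : f (+ 4) ≈ + 4 [ m ]
      f4 = f4-by (+ 1) u≈1
      G : f (f (+ 1)) ≈ f (+ 3) + + 1 * (f (+ 1) - + 3) [ m ]
      G = slope-by (+ 1) u≈1 f1≈3
      G′ : f (f (+ 3)) ≈ f (+ 1) + + 1 * (f (+ 3) - + 1) [ m ]
      G′ = slope-by (+ 1) u≈1 f3≈1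
      D : f (+ 4) - f (+ 2) ≈ f (+ 3) - f (+ 1) [ m ]
      D = lin₄ e13 e11 G′ G (+ 1) (- + 1) (r (+ 1)) (- r (+ 1))
        (solve 7 (λ a b c d e g h → a :- b :- (c :- d) := Κ 1ℤ :*
          (a :- (d :+ c :+ e :* (g :- Κ (+ 3)))) :+ Κ -1ℤ :* (b :- (d :+ d :+ e :* (h :- Κ 1ℤ))) :+
          e :* (g :- (d :+ Κ 1ℤ :* (c :- Κ 1ℤ))) :+ (:- e) :* (h :- (c :+ Κ 1ℤ :* (d :- Κ (+ 3)))))
          refl (f (+ 4)) (f (+ 2)) (f (+ 3)) (f (+ 1)) (r (+ 1)) (f (f (+ 3))) (f (f (+ 1))))
      D′ : f (+ 6) - f (+ 4) ≈ f (+ 3) - f (+ 1) [ m ]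
      D′ = lin₄ e33 e31 G′ G (+ 1) (- + 1) (r (+ 3)) (- r (+ 3))
        (solve 7 (λ a b c d e g h → a :- b :- (c :- d) := Κ 1ℤ :*
          (a :- (c :+ c :+ e :* (g :- Κ (+ 3)))) :+ Κ -1ℤ :* (b :- (c :+ d :+ e :* (h :- Κ 1ℤ))) :+
          e :* (g :- (d :+ Κ 1ℤ :* (c :- Κ 1ℤ))) :+ (:- e) :* (h :- (c :+ Κ 1ℤ :* (d :- Κ (+ 3)))))
          refl (f (+ 6)) (f (+ 4)) (f (+ 3)) (f (+ 1)) (r (+ 3)) (f (f (+ 3))) (f (f (+ 1))))
      f2 : f (+ 2) ≈ + 2 [ m ]
      f2 = half (lin₂ (negative (+ 2)) 4≈0 (+ 1) (- + 1)
        (solve 1 (λ a → a :- Κ (+ 2) := Κ 1ℤ :* (a :- :- Κ (+ 2)) :+ Κ -1ℤ :* (Κ (+ 4) :- Κ 0ℤ))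
          refl (f (+ 2))))
                (lin₄ D′ D k42 f4 (+ 1) (- + 1) (- + 1) (+ 1)
                  (solve 5 (λ a b c d e → Κ (+ 2) :* a :- Κ (+ 2) :* Κ (+ 2) := Κ 1ℤ :*
                    (b :- c :- (d :- e)) :+ Κ -1ℤ :* (c :- a :- (d :- e)) :+ Κ -1ℤ :*
                    (b :- (c :+ a)) :+ Κ 1ℤ :* (c :- Κ (+ 4))) refl (f (+ 2)) (f (+ 6)) (f (+ 4))
                    (f (+ 3)) (f (+ 1))))

    -- For u ≡ -1 the defects at 1 and 3 are opposite, so r cancels from f(2) + f(4) and from f(6) +
    -- f(4). With f(6) = f(4) + f(2) and f(4) = -4 this gives f(1) = f(3) + 2, and the defect at 1
    -- is f(3) - f(1) + 2.
    no-defect : u - (- + 1) ≈ + 0 [ + p ] → f (f (+ 1)) - + 1 ≈ + 0 [ m ]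
    no-defect u≈-1 = lin₂ G f1≈f3+2 (+ 1) (- + 1)
      (solve 3 (λ a b c → a :- Κ 1ℤ :- Κ 0ℤ := Κ 1ℤ :* (a :- (b :+ Κ -1ℤ :* (c :- Κ (+ 3)))) :+ Κ
        -1ℤ :* (c :- (b :+ Κ (+ 2)))) refl (f (f (+ 1))) (f (+ 3)) (f (+ 1)))
      where
      f4 : f (+ 4) ≈ (- + 1) * + 4 [ m ]
      f4 = f4-by (- + 1) u≈-1
      G : f (f (+ 1)) ≈ f (+ 3) + (- + 1) * (f (+ 1) - + 3) [ m ]
      G = slope-by (- + 1) u≈-1 f1≈3
      G′ : f (f (+ 3)) ≈ f (+ 1) + (- + 1) * (f (+ 3) - + 1) [ m ]
      G′ = slope-by (- + 1) u≈-1 f3≈1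
      D : f (+ 2) + f (+ 4) ≈ + 3 * f (+ 1) + f (+ 3) [ m ]
      D = lin₄ e11 e13 G G′ (+ 1) (+ 1) (r (+ 1)) (r (+ 1))
        (solve 7 (λ a b c d e g h → a :+ b :- (Κ (+ 3) :* c :+ d) := Κ 1ℤ :*
          (a :- (c :+ c :+ e :* (g :- Κ 1ℤ))) :+ Κ 1ℤ :* (b :- (c :+ d :+ e :* (h :- Κ (+ 3)))) :+ e
          :* (g :- (d :+ Κ -1ℤ :* (c :- Κ (+ 3)))) :+ e :* (h :- (c :+ Κ -1ℤ :* (d :- Κ 1ℤ)))) refl
          (f (+ 2)) (f (+ 4)) (f (+ 1)) (f (+ 3)) (r (+ 1)) (f (f (+ 1))) (f (f (+ 3))))
      D′ : f (+ 6) + f (+ 4) ≈ + 3 * f (+ 3) + f (+ 1) [ m ]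
      D′ = lin₄ e33 e31 G G′ (+ 1) (+ 1) (r (+ 3)) (r (+ 3))
        (solve 7 (λ a b c d e g h → a :+ b :- (Κ (+ 3) :* c :+ d) := Κ 1ℤ :*
          (a :- (c :+ c :+ e :* (g :- Κ (+ 3)))) :+ Κ 1ℤ :* (b :- (c :+ d :+ e :* (h :- Κ 1ℤ))) :+ e
          :* (h :- (c :+ Κ -1ℤ :* (d :- Κ (+ 3)))) :+ e :* (g :- (d :+ Κ -1ℤ :* (c :- Κ 1ℤ)))) refl
          (f (+ 6)) (f (+ 4)) (f (+ 3)) (f (+ 1)) (r (+ 3)) (f (f (+ 3))) (f (f (+ 1))))
      f1≈f3+2 : f (+ 1) ≈ f (+ 3) + + 2 [ m ]
      f1≈f3+2 = half (lin₂ f1≈3 f3≈1 (+ 1) (- + 1)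
        (solve 2 (λ a b → a :- (b :+ Κ (+ 2)) := Κ 1ℤ :* (a :- Κ (+ 3)) :+ Κ -1ℤ :* (b :- Κ 1ℤ))
          refl (f (+ 1)) (f (+ 3))))
                     (lin₄ D′ D k42 f4 (+ 1) (- + 1) (- + 1) (- + 1)
                       (solve 5 (λ a b c d e → Κ (+ 2) :* a :- Κ (+ 2) :* (b :+ Κ (+ 2)) := Κ 1ℤ :*
                         (c :+ d :- (Κ (+ 3) :* b :+ a)) :+ Κ -1ℤ :* (e :+ d :- (Κ (+ 3) :* a :+ b))
                         :+ Κ -1ℤ :* (c :- (d :+ e)) :+ Κ -1ℤ :* (d :- Κ -1ℤ :* Κ (+ 4))) refl
                         (f (+ 1)) (f (+ 3)) (f (+ 6)) (f (+ 4)) (f (+ 2))))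

    -- Applying the slope twice, f(f(4)) = 4u², so the hypothesis reads 4(u² - 1) ≡ 0 modulo 4p.
    u²≈1 : f (f (+ 4)) - + 4 ≈ + 0 [ m ] → (u - + 1) * (u + + 1) ≈ + 0 [ + p ]
    u²≈1 h = unscale (+ 4) (≈-modulus (pos-* 4 p)
      (lin₄ h (slope f4≈0) f0 (≡⇒≈ f4≡u4) (+ 1) (- + 1) (- + 1) (- u)
        (solve 4 (λ a b c d → Κ (+ 4) :* ((a :- Κ 1ℤ) :* (a :+ Κ 1ℤ)) :- Κ (+ 4) :* Κ 0ℤ := Κ 1ℤ :*
          (b :- Κ (+ 4) :- Κ 0ℤ) :+ Κ -1ℤ :* (b :- (c :+ a :* (d :- Κ 0ℤ))) :+ Κ -1ℤ :* (c :- Κ 0ℤ)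
          :+ (:- a) :* (d :- a :* Κ (+ 4))) refl u (f (f (+ 4))) (f (+ 0)) (f (+ 4)))))

    -- Again f(5) is computed in two ways: r(1) times the defect at 4 vanishes modulo 4p. Either
    -- r(1) ≡ 0 and f is additive, or u ≡ ±1.
    outcome : Outcome
    outcome = [
        (λ r≈0 → inj₁ (additive r≈0))
      , (λ h → [
            (λ u≈1 → inj₂ (inj₁ (parity-type u≈1)))
          , (λ u≈-1 → inj₁ (additive′ (no-defect (lin₁ u≈-1 (+ 1)
            (solve 1 (λ a → a :- Κ -1ℤ :- Κ 0ℤ := Κ 1ℤ :* (a :+ Κ 1ℤ :- Κ 0ℤ)) refl u))))) ]′
          (euclid pr (u - + 1) (u + + 1) (u²≈1 h))) ]′
      (divide {r (+ 1)} {f (f (+ 4)) - + 4} (defect≈0 (+ 4)) (lin₂ e14 k41 (- + 1) (+ 1)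
        (solve 5 (λ a b c d e → a :* (b :- Κ (+ 4)) :- Κ 0ℤ := Κ -1ℤ :*
          (c :- (d :+ e :+ a :* (b :- Κ (+ 4)))) :+ Κ 1ℤ :* (c :- (e :+ d))) refl (r (+ 1))
          (f (f (+ 4))) (f (+ 5)) (f (+ 1)) (f (+ 4)))))

  positive-outcome : (∀ x → f x ≈ x [ + 4 ]) → Outcome
  positive-outcome fixed = Positive.outcome fixed (λ j → geometric u (π j)) λ j l →
    lin₂ (skew j l) (iter-affine (π j) l) (+ 1) (+ 1)
      (solve 6 (λ a b c d e g → a :- (b :+ c :+ d :* (e :- c)) := Κ 1ℤ :* (a :- (b :+ g)) :+ Κ 1ℤ :*
        (g :- (c :+ d :* (e :- c)))) refl (f (j + l)) (f j) l (geometric u (π j)) (f l)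
        (iter f (π j) l))
    where
    open AffineOnClasses {m} {u} {f} fixed slope

  negative-outcome : (∀ x → f x ≈ - x [ + 4 ]) → Outcome
  negative-outcome negative = Negative.outcome negative
    (λ j → proj₁ (expand j)) (λ j → proj₂ (expand j))
    where
    f² : ℤ → ℤ
    f² x = f (f x)
    f²-fixed : ∀ x → f² x ≈ x [ + 4 ]
    f²-fixed x = lin₂ (negative (f x)) (negative x) (+ 1) (- + 1) refl′
      where
      refl′ : f (f x) - x ≡ + 1 * (f (f x) - - f x) + - + 1 * (f x - - x)
      refl′ =
        solve 3 (λ a b c → a :- b := Κ 1ℤ :* (a :- :- c) :+ Κ -1ℤ :* (c :- :- b)) refl (f (f x)) x
          (f x)
    f²-slope : ∀ {x y} → x ≈ y [ + 4 ] → f (f x) ≈ f (f y) + u * u * (x - y) [ m ]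
    f²-slope {x} {y} x≈y = lin₂ (slope {f x} {f y}
      (lin₃ (negative x) (negative y) x≈y (+ 1) (- + 1) (- + 1)
        (solve 4 (λ a b c d → a :- b := Κ 1ℤ :* (a :- :- c) :+ Κ -1ℤ :* (b :- :- d) :+ Κ -1ℤ :*
          (c :- d)) refl (f x) (f y) x y))) (slope x≈y) (+ 1) u
        (solve 7 (λ a b c d e g h → a :- (b :+ c :* c :* (d :- e)) := Κ 1ℤ :*
          (a :- (b :+ c :* (g :- h))) :+ c :* (g :- (h :+ c :* (d :- e)))) refl (f (f x)) (f (f y))
          u x y (f x) (f y))
    open AffineOnClasses {m} {u * u} {f²} f²-fixed f²-slope

    expand : ∀ j → Σ ℤ λ r → ∀ l → f (j + l) ≈ f j + f l + r * (f (f l) - l) [ m ]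
    expand j = go (halve (π j))
      where
      go : (Σ ℕ λ e → π j ≡ e ℕ.+ e ⊎ π j ≡ suc (e ℕ.+ e)) →
           Σ ℤ λ r → ∀ l → f (j + l) ≈ f j + f l + r * (f (f l) - l) [ m ]
      -- An even power fixes 1 modulo 4, giving f(j + 1) ≡ f(j) + 1, while x ↦ -x gives f(j) - 1.
      -- This would force 2 ≡ 0 modulo 4.
      go (e , inj₁ even) = contradiction
        (lin₄ skew-1 (iter-fixed e (+ 1)) (negative (j + + 1)) (negative j) (- + 1) (- + 1) (+ 1) (- + 1)
          (solve 4 (λ a b c d → Κ (+ 2) :- Κ 0ℤ := Κ -1ℤ :* (a :- (b :+ c)) :+ Κ -1ℤ :* (c :- Κ 1ℤ)
            :+ Κ 1ℤ :* (a :- :- (d :+ Κ 1ℤ)) :+ Κ -1ℤ :* (b :- :- d)) refl (f (j + + 1)) (f j)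
            (iter f² e (+ 1)) j)) ¬2
        where
        skew-1 : f (j + + 1) ≈ f j + iter f² e (+ 1) [ + 4 ]
        skew-1 = ≈-weaken (+ p) (≈-modulus (trans (pos-* 4 p)
          (solve 1 (λ a → Κ (+ 4) :* a := a :* Κ (+ 4)) refl (+ p))) (≈-trans (skew j (+ 1))
          (≡⇒≈ (cong (λ z → f j + z)
            (trans (cong (λ i → iter f i (+ 1)) even) (iter-double f e (+ 1)))))))
      go (e , inj₂ odd) = u * geometric (u * u) e , λ l →
        lin₄ (skew j l) (unfold l) (slope (iter-fixed e l)) (iter-affine′ l) (+ 1) (+ 1) (+ 1) u
          (solve 10 (λ a b c d e g h i j k → a :- (b :+ c :+ d :* e :* (g :- h)) := Κ 1ℤ :*
            (a :- (b :+ i)) :+ Κ 1ℤ :* (i :- j) :+ Κ 1ℤ :* (j :- (c :+ d :* (k :- h))) :+ d :*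
            (k :- (h :+ e :* (g :- h)))) refl (f (j + l)) (f j) (f l) u (geometric (u * u) e)
            (f (f l)) l (iter f (π j) l) (f (iter f² e l)) (iter f² e l))
        where
        unfold : ∀ l → iter f (π j) l ≈ f (iter f² e l) [ m ]
        unfold l = ≡⇒≈ (trans (cong (λ i → iter f i l) odd) (cong f (iter-double f e l)))
        iter-affine′ : ∀ l → iter f² e l ≈ l + geometric (u * u) e * (f (f l) - l) [ m ]
        iter-affine′ = iter-affine e

  outcome : Outcome
  outcome = [ positive-outcome , negative-outcome ]′ sign

-- Transfer between `Fin n` and ℤ, and shifts by geometric sums.

module FinLift (n : ℕ) .{{_ : NonZero n}} where
  open Cyclic n using (_⊕_; e; IsSkewMorphism; IsAutomorphism; IsProperSkewMorphism; xperm; yperm; zperm)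
    renaming (iter to iterF)

  toZ : Fin n → ℤ
  toZ a = + toℕ a

  toF : ℤ → Fin n
  toF x = fromℕ< (n%ℕd<d x n)

  toZ-toF : ∀ x → toZ (toF x) ≈ x [ + n ]
  toZ-toF x = ≈-trans (≡⇒≈ (cong +_ (Fin.toℕ-fromℕ< (n%ℕd<d x n)))) (≈-sym (residue x n))

  toZ-injective : ∀ {a c} → toZ a ≈ toZ c [ + n ] → a ≡ c
  toZ-injective {a} {c} p = Fin.toℕ-injective (residues-unique (Fin.toℕ<n a) (Fin.toℕ<n c) p)

  toF-toZ : ∀ a → toF (toZ a) ≡ a
  toF-toZ a = toZ-injective (toZ-toF (toZ a))

  toF-cong : ∀ {x y} → x ≈ y [ + n ] → toF x ≡ toF y
  toF-cong {x} {y} p = toZ-injective (≈-trans (toZ-toF x) (≈-trans p (≈-sym (toZ-toF y))))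

  mod-≈ : ∀ k → toZ (k mod n) ≈ + k [ + n ]
  mod-≈ k = ≈-trans (≡⇒≈ (cong +_ (Fin.toℕ-fromℕ< _))) (≈-sym (residue (+ k) n))

  ⊕-≈ : ∀ a c → toZ (a ⊕ c) ≈ toZ a + toZ c [ + n ]
  ⊕-≈ a c = ≈-trans (mod-≈ (toℕ a ℕ.+ toℕ c)) (≡⇒≈ (pos-+ (toℕ a) (toℕ c)))

  lift : (Fin n → Fin n) → ℤ → ℤ
  lift φ x = toZ (φ (toF x))

  lift-toZ : ∀ φ a → lift φ (toZ a) ≡ toZ (φ a)
  lift-toZ φ a = cong (λ c → toZ (φ c)) (toF-toZ a)

  lift-resp : ∀ φ {x y} → x ≈ y [ + n ] → lift φ x ≈ lift φ y [ + n ]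
  lift-resp φ p = ≡⇒≈ (cong (λ c → toZ (φ c)) (toF-cong p))

  iter-lift : ∀ φ k a → iter (lift φ) k (toZ a) ≡ toZ (iterF φ k a)
  iter-lift φ zero    a = refl
  iter-lift φ (suc k) a = trans (cong (lift φ) (iter-lift φ k a)) (lift-toZ φ (iterF φ k a))

  iter-lift-resp : ∀ φ k {x y} → x ≈ y [ + n ] → iter (lift φ) k x ≈ iter (lift φ) k y [ + n ]
  iter-lift-resp φ zero    p = p
  iter-lift-resp φ (suc k) p = lift-resp φ (iter-lift-resp φ k p)

  lift-skew : ∀ {φ} → IsSkewMorphism φ → Skew (+ n) (lift φ)
  lift-skew {φ} ((inj , _) , φe≡e , pow) = record
    { resp = lift-resp φ
    ; inj  = λ {x} {y} p → ≈-trans (≈-sym (toZ-toF x))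
        (≈-trans (≡⇒≈ (cong toZ (inj (toZ-injective p)))) (toZ-toF y))
    ; f0   = ≈-trans (lift-resp φ (≈-sym (mod-≈ 0)))
        (≈-trans (≡⇒≈ (trans (lift-toZ φ e) (cong toZ φe≡e))) (mod-≈ 0))
    ; π    = power
    ; skew = λ a c → ≈-trans (lift-resp φ (sum a c)) (≈-trans
        (≡⇒≈ (trans (lift-toZ φ (toF a ⊕ toF c)) (cong toZ (proj₂ (proj₂ (pow (toF a))) (toF c)))))
        (≈-trans (⊕-≈ (φ (toF a)) (iterF φ (power a) (toF c))) (+-mono (≈-refl {toZ (φ (toF a))})
          (≈-trans (≡⇒≈ (sym (iter-lift φ (power a) (toF c))))
            (iter-lift-resp φ (power a) (toZ-toF c))))))
    }
    where
    power : ℤ → ℕ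
    power a = proj₁ (pow (toF a))
    sum : ∀ a c → a + c ≈ toZ (toF a ⊕ toF c) [ + n ]
    sum a c = lin₃ (⊕-≈ (toF a) (toF c)) (toZ-toF a) (toZ-toF c) (- + 1) (- + 1) (- + 1)
      (solve 5 (λ a b c d e → a :+ b :- c := Κ -1ℤ :* (c :- (d :+ e)) :+ Κ -1ℤ :* (d :- a) :+ Κ -1ℤ
        :* (e :- b)) refl a c (toZ (toF a ⊕ toF c)) (toZ (toF a)) (toZ (toF c)))

  linear⇒additive : ∀ {φ} c → (∀ k → lift φ (+ k) ≈ c * + k [ + n ]) → ∀ a b → φ (a ⊕ b) ≡ φ a ⊕ φ b
  linear⇒additive {φ} c h a b = toZ-injective (≈-trans (value (a ⊕ b)) (≈-trans (*-monoʳ c (⊕-≈ a b))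
    (≈-trans (lin₂ {x = c * (toZ a + toZ b)} {toZ (φ a) + toZ (φ b)} (value a) (value b) (- + 1) (- + 1)
      (solve 5 (λ a b c d e → a :* (b :+ c) :- (d :+ e) := Κ -1ℤ :* (d :- a :* b) :+ Κ -1ℤ :*
        (e :- a :* c)) refl c (toZ a) (toZ b) (toZ (φ a)) (toZ (φ b))))
      (≈-sym (⊕-≈ (φ a) (φ b))))))
    where
    value : ∀ a → toZ (φ a) ≈ c * toZ a [ + n ]
    value a = ≈-trans (≡⇒≈ (sym (lift-toZ φ a))) (h (toℕ a))

  identify : ∀ {φ ψ : Fin n → Fin n} {r s} (c : ℕ → ℤ) →
             (∀ k → lift φ (+ k) ≈ + k + r * c k [ + n ]) → r ≈ s [ + n ] →
             (∀ a → toZ (ψ a) ≈ toZ a + s * c (toℕ a) [ + n ]) → ∀ a → φ a ≡ ψ a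
  identify {φ} {ψ} {r} {s} c h r≈s g a = toZ-injective (≈-trans (≡⇒≈ (sym (lift-toZ φ a)))
    (≈-trans (h (toℕ a)) (≈-trans (transfer (toZ a) (c (toℕ a))) (≈-sym (g a)))))
    where
    transfer : ∀ x y → x + r * y ≈ x + s * y [ + n ]
    transfer x y = lin₁ r≈s y
      (solve 4 (λ a b c d → a :+ b :* c :- (a :+ d :* c) := c :* (b :- d)) refl x r y s)

  -- d is the period of the shift: 2 for x_s and y_s, 4 for z_{ω,s}. As d divides n, the shift
  -- depends only on the residue modulo n, although geometric sums are indexed by natural numbers.
  module ShiftByGeometric {φ : Fin n → Fin n} {ω d : ℕ} .{{_ : NonZero d}} {s : ℤ} (0<ω : 0 ℕ.< ω)
         (formula : ∀ a → toZ (φ a) ≈ toZ a + s * geometric (+ ω) (toℕ a) [ + n ])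
         (n≈0 : + n ≈ + 0 [ + d ]) (s≈0 : s ≈ + 0 [ + d ])
         (periodic : ∀ k → s * geometric (+ ω) (d ℕ.+ k) ≈ s * geometric (+ ω) k [ + n ]) where

    γ : ℕ → ℤ
    γ k = s * geometric (+ ω) k

    weaken : ∀ {x y} → x ≈ y [ + n ] → x ≈ y [ + d ]
    weaken {x} {y} (mk (divides q h)) = lin₂ (≡⇒≈ {x - y} h) n≈0 (+ 1) q
      (solve 4 (λ a b c d → a :- b := Κ 1ℤ :* (a :- b :- c :* d) :+ c :* (d :- Κ 0ℤ)) refl x y q
        (+ n))

    γ-% : ∀ k → γ k ≈ γ (k ℕ.% d) [ + n ]
    γ-% k = ≈-trans (≡⇒≈ (cong γ (trans (ℕ.m≡m%n+[m/n]*n k d) (ℕ.+-comm (k ℕ.% d) _)))) (drop (k ℕ./ d))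
      where
      drop : ∀ t → γ (t ℕ.* d ℕ.+ k ℕ.% d) ≈ γ (k ℕ.% d) [ + n ]
      drop zero    = ≈-refl
      drop (suc t) = ≈-trans (≡⇒≈ (cong γ (ℕ.+-assoc d (t ℕ.* d) _))) (≈-trans (periodic _) (drop t))

    γ-cong : ∀ j k → + j ≈ + k [ + d ] → γ j ≈ γ k [ + n ]
    γ-cong j k p = ≈-trans (γ-% j) (≈-trans (≡⇒≈ (cong γ (residues-unique (ℕ.m%n<n j d) (ℕ.m%n<n k d)
      (≈-trans (≈-sym (residue (+ j) d)) (≈-trans p (residue (+ k) d)))))) (≈-sym (γ-% k)))

    fixes-classes : ∀ a → toZ (φ a) ≈ toZ a [ + d ]
    fixes-classes a = lin₂ (weaken (formula a)) s≈0 (+ 1) (geometric (+ ω) (toℕ a))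
      (solve 4 (λ a b c d → a :- b := Κ 1ℤ :* (a :- (b :+ c :* d)) :+ d :* (c :- Κ 0ℤ)) refl
        (toZ (φ a)) (toZ a) s (geometric (+ ω) (toℕ a)))

    -- d divides s, so φ keeps classes modulo d, and the shift depends only on the class: each
    -- application adds the same amount.
    iter-formula : ∀ k a → toZ (iterF φ k a) ≈ toZ a + + k * γ (toℕ a) [ + n ]
    iter-classes : ∀ k a → toZ (iterF φ k a) ≈ toZ a [ + d ]
    iter-classes zero    a = ≈-refl
    iter-classes (suc k) a = ≈-trans (fixes-classes (iterF φ k a)) (iter-classes k a)
    iter-formula zero    a = ≡⇒≈
      (solve 3 (λ b c d → b := b :+ Κ 0ℤ :* (c :* d)) refl (toZ a) s (geometric (+ ω) (toℕ a)))
    iter-formula (suc k) a = step (iterF φ k a) (iter-classes k a) (iter-formula k a)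
      where
      step : ∀ b → toZ b ≈ toZ a [ + d ] → toZ b ≈ toZ a + + k * γ (toℕ a) [ + n ] →
             toZ (φ b) ≈ toZ a + + suc k * γ (toℕ a) [ + n ]
      step b b≈a p = lin₃ (formula b) (γ-cong _ _ b≈a) p (+ 1) (+ 1) (+ 1)
        (solve 7 (λ a b c d e g h → a :- (b :+ (Κ 1ℤ :+ c) :* (d :* e)) := Κ 1ℤ :*
          (a :- (g :+ d :* h)) :+ Κ 1ℤ :* (d :* h :- d :* e) :+ Κ 1ℤ :* (g :- (b :+ c :* (d :* e))))
          refl (toZ (φ b)) (toZ a) (+ k) s (geometric (+ ω) (toℕ a)) (toZ b)
          (geometric (+ ω) (toℕ b)))

    -- The sum is split after its first j terms. The factor ω^j of the rest is the power that the
    -- skew law attaches to j.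
    geometric-+ : ∀ j k → geometric (+ ω) (j ℕ.+ k) ≡ geometric (+ ω) j + + (ω ℕ.^ j) * geometric (+ ω) k
    geometric-+ zero    k = trans {j = + 0 + + 1 * geometric (+ ω) k}
      (solve 1 (λ b → b := Κ 0ℤ :+ Κ 1ℤ :* b) refl (geometric (+ ω) k)) refl
    geometric-+ (suc j) k = trans (cong (λ g → + 1 + + ω * g) (geometric-+ j k))
      (trans {j = + 1 + + ω * geometric (+ ω) j + (+ ω * + (ω ℕ.^ j)) * geometric (+ ω) k}
        (solve 4 (λ a b c d → Κ 1ℤ :+ a :* (b :+ c :* d) := Κ 1ℤ :+ a :* b :+ a :* c :* d) refl
          (+ ω) (geometric (+ ω) j) (+ (ω ℕ.^ j)) (geometric (+ ω) k))
        (cong (λ v → + 1 + + ω * geometric (+ ω) j + v * geometric (+ ω) k) (sym (pos-* ω (ω ℕ.^ j)))))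

    skew : ∀ a c → φ (a ⊕ c) ≡ φ a ⊕ iterF φ (ω ℕ.^ toℕ a) c
    skew a c = toZ-injective (go (a ⊕ c) (iterF φ (ω ℕ.^ toℕ a) c) (⊕-≈ a c)
      (iter-formula (ω ℕ.^ toℕ a) c) (⊕-≈ (φ a) _))
      where
      go : ∀ b i {r} → toZ b ≈ toZ a + toZ c [ + n ] →
           toZ i ≈ toZ c + + (ω ℕ.^ toℕ a) * γ (toℕ c) [ + n ] →
           r ≈ toZ (φ a) + toZ i [ + n ] → toZ (φ b) ≈ r [ + n ]
      go b i b≈ i≈ r≈ = ≈-trans (formula b) (≈-trans
        (lin₃ {y = toZ (φ a) + toZ i} split i≈ (formula a) (+ 1) (- + 1) (- + 1)
          (solve 10 (λ a b c d e g h i j k → a :+ b :* c :- (d :+ e) := Κ 1ℤ :*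
            (a :+ b :* c :- (g :+ h :+ b :* (i :+ j :* k))) :+ Κ -1ℤ :* (e :- (h :+ j :* (b :* k)))
            :+ Κ -1ℤ :* (d :- (g :+ b :* i))) refl (toZ b) s (geometric (+ ω) (toℕ b)) (toZ (φ a))
            (toZ i) (toZ a) (toZ c) (geometric (+ ω) (toℕ a)) (+ (ω ℕ.^ toℕ a))
            (geometric (+ ω) (toℕ c)))) (≈-sym r≈))
        where
        γ-b : γ (toℕ b) ≈ γ (toℕ a ℕ.+ toℕ c) [ + n ]
        γ-b = γ-cong _ _ (weaken (≈-trans b≈ (≡⇒≈ (sym (pos-+ (toℕ a) (toℕ c))))))
        split : toZ b + s * geometric (+ ω) (toℕ b) ≈
                toZ a + toZ c + s * (geometric (+ ω) (toℕ a)
                                     + + (ω ℕ.^ toℕ a) * geometric (+ ω) (toℕ c)) [ + n ]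
        split = lin₃ b≈ γ-b (≡⇒≈ (cong (λ z → s * z) (geometric-+ (toℕ a) (toℕ c)))) (+ 1) (+ 1) (+ 1)
          (solve 9 (λ a b c d e g h i j → a :+ b :* c :- (d :+ e :+ b :* (g :+ h :* i)) := Κ 1ℤ :*
            (a :- (d :+ e)) :+ Κ 1ℤ :* (b :* c :- b :* j) :+ Κ 1ℤ :* (b :* j :- b :* (g :+ h :* i)))
            refl (toZ b) s (geometric (+ ω) (toℕ b)) (toZ a) (toZ c) (geometric (+ ω) (toℕ a))
            (+ (ω ℕ.^ toℕ a)) (geometric (+ ω) (toℕ c)) (geometric (+ ω) (toℕ a ℕ.+ toℕ c)))

    φ-injective : ∀ {a c} → φ a ≡ φ c → a ≡ c
    φ-injective {a} {c} p = toZ-injective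
      (lin₄ (formula a) (formula c) (≡⇒≈ (cong toZ p)) (γ-cong _ _ a≈c) (- + 1) (+ 1) (+ 1) (- + 1)
        (solve 7 (λ a b c d e g h → a :- b := Κ -1ℤ :* (c :- (a :+ d :* e)) :+ Κ 1ℤ :*
          (g :- (b :+ d :* h)) :+ Κ 1ℤ :* (c :- g) :+ Κ -1ℤ :* (d :* e :- d :* h)) refl (toZ a)
          (toZ c) (toZ (φ a)) s (geometric (+ ω) (toℕ a)) (toZ (φ c)) (geometric (+ ω) (toℕ c))))
      where
      a≈c : toZ a ≈ toZ c [ + d ]
      a≈c = ≈-trans (≈-sym (fixes-classes a)) (≈-trans (≡⇒≈ (cong toZ p)) (fixes-classes c))

    φ-surjective : ∀ c → Σ (Fin n) λ a → ∀ {b} → b ≡ a → φ b ≡ c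
    φ-surjective c = toF (toZ c - γ (toℕ c)) ,
      λ { refl → toZ-injective (go _ (toZ-toF (toZ c - γ (toℕ c)))) }
      where
      go : ∀ a → toZ a ≈ toZ c - γ (toℕ c) [ + n ] → toZ (φ a) ≈ toZ c [ + n ]
      go a a≈ = lin₃ (formula a) a≈ (γ-cong _ _ a≈c) (+ 1) (+ 1) (+ 1)
        (solve 6 (λ a b c d e g → a :- b := Κ 1ℤ :* (a :- (c :+ d :* e)) :+ Κ 1ℤ :*
          (c :- (b :- d :* g)) :+ Κ 1ℤ :* (d :* e :- d :* g)) refl (toZ (φ a)) (toZ c) (toZ a) s
          (geometric (+ ω) (toℕ a)) (geometric (+ ω) (toℕ c)))
        where
        a≈c : toZ a ≈ toZ c [ + d ]
        a≈c = lin₂ (weaken a≈) s≈0 (+ 1) (- geometric (+ ω) (toℕ c))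
          (solve 4 (λ a b c d → a :- b := Κ 1ℤ :* (a :- (b :- c :* d)) :+ (:- d) :* (c :- Κ 0ℤ))
            refl (toZ a) (toZ c) s (geometric (+ ω) (toℕ c)))

    fixes-e : φ e ≡ e
    fixes-e = toZ-injective (go e (mod-≈ 0))
      where
      go : ∀ a → toZ a ≈ + 0 [ + n ] → toZ (φ a) ≈ toZ a [ + n ]
      go a a≈0 = lin₂ (formula a) γ≈0 (+ 1) (+ 1)
        (solve 4 (λ a b c d → a :- b := Κ 1ℤ :* (a :- (b :+ c :* d)) :+ Κ 1ℤ :* (c :* d :- Κ 0ℤ))
          refl (toZ (φ a)) (toZ a) s (geometric (+ ω) (toℕ a)))
        where
        γ≈0 : s * geometric (+ ω) (toℕ a) ≈ + 0 [ + n ]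
        γ≈0 = ≈-trans (γ-cong (toℕ a) 0 (weaken a≈0)) (≡⇒≈ {s * + 0}
          (solve 1 (λ a → a :* Κ 0ℤ := Κ 0ℤ) refl s))

    isSkewMorphism : IsSkewMorphism φ
    isSkewMorphism = (φ-injective , φ-surjective) , fixes-e
      , λ a → ω ℕ.^ toℕ a , ℕ.m^n>0 ω {{ℕ.>-nonZero 0<ω}} (toℕ a) , skew a

    -- Additivity at 1 + 1 compares 2 + s(1 + ω) with 2(1 + s).
    additive⇒ : (∀ a c → φ (a ⊕ c) ≡ φ a ⊕ φ c) → s * (+ ω - + 1) ≈ + 0 [ + n ]
    additive⇒ add = go (toF (+ 1)) (toF (+ 1) ⊕ toF (+ 1)) (toZ-toF (+ 1)) (⊕-≈ (toF (+ 1)) (toF (+ 1)))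
      (≈-trans (≡⇒≈ (cong toZ (add (toF (+ 1)) (toF (+ 1))))) (⊕-≈ (φ (toF (+ 1))) (φ (toF (+ 1)))))
      where
      go : ∀ a b → toZ a ≈ + 1 [ + n ] → toZ b ≈ toZ a + toZ a [ + n ] →
           toZ (φ b) ≈ toZ (φ a) + toZ (φ a) [ + n ] → s * (+ ω - + 1) ≈ + 0 [ + n ]
      go a b a≈1 b≈ φb≈ = combine γa γb
        where
        γa : s * geometric (+ ω) (toℕ a) ≈ s * (+ 1 + + ω * + 0) [ + n ]
        γa = γ-cong (toℕ a) 1 (weaken a≈1)
        γb : s * geometric (+ ω) (toℕ b) ≈ s * (+ 1 + + ω * (+ 1 + + ω * + 0)) [ + n ]
        γb = γ-cong (toℕ b) 2 (weaken (lin₂ b≈ a≈1 (+ 1) (+ 2)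
          (solve 2 (λ b c → b :- Κ (+ 2) := Κ 1ℤ :* (b :- (c :+ c)) :+ Κ (+ 2) :* (c :- Κ 1ℤ)) refl
            (toZ b) (toZ a))))
        sums : toZ b + s * geometric (+ ω) (toℕ b) ≈ (+ 2) * (toZ a + s * geometric (+ ω) (toℕ a)) [ + n ]
        sums = lin₃ (formula a) (formula b) φb≈ (+ 2) (- + 1) (+ 1)
          (solve 7 (λ a b c d e g h → a :+ b :* c :- Κ (+ 2) :* (d :+ b :* e) := Κ (+ 2) :*
            (g :- (d :+ b :* e)) :+ Κ -1ℤ :* (h :- (a :+ b :* c)) :+ Κ 1ℤ :* (h :- (g :+ g))) refl
            (toZ b) s (geometric (+ ω) (toℕ b)) (toZ a) (geometric (+ ω) (toℕ a)) (toZ (φ a))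
            (toZ (φ b)))
        combine : s * geometric (+ ω) (toℕ a) ≈ s * (+ 1 + + ω * + 0) [ + n ] →
                  s * geometric (+ ω) (toℕ b) ≈ s * (+ 1 + + ω * (+ 1 + + ω * + 0)) [ + n ] →
                  s * (+ ω - + 1) ≈ + 0 [ + n ]
        combine γa γb = lin₄ sums b≈ γa γb (+ 1) (- + 1) (+ 2) (- + 1)
          (solve 6 (λ a b c d e g → a :* (b :- Κ 1ℤ) :- Κ 0ℤ := Κ 1ℤ :*
            (c :+ a :* d :- Κ (+ 2) :* (e :+ a :* g)) :+ Κ -1ℤ :* (c :- (e :+ e)) :+ Κ (+ 2) :*
            (a :* g :- a :* (Κ 1ℤ :+ b :* Κ 0ℤ)) :+ Κ -1ℤ :*
            (a :* d :- a :* (Κ 1ℤ :+ b :* (Κ 1ℤ :+ b :* Κ 0ℤ)))) refl s (+ ω) (toZ b)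
            (geometric (+ ω) (toℕ b)) (toZ a) (geometric (+ ω) (toℕ a)))

-- The sums 1 + ω + ... + ω^(k-1) for k < 4, reduced by ω² ≡ -1.
coefficient : ℕ → ℕ → ℕ
coefficient ω 1 = 1
coefficient ω 2 = ω ℕ.+ 1
coefficient ω 3 = ω
coefficient ω _ = 0

module PermutationFormulas (n : ℕ) .{{_ : NonZero n}} where
  open Cyclic n
  open FinLift n using (toZ; mod-≈)

  private
    shifted : ∀ k s c {x} → x ≡ s ℕ.* c → + (k ℕ.+ x) ≡ + k + + s * + c
    shifted k s c refl = trans (pos-+ k (s ℕ.* c)) (cong (λ z → + k + z) (pos-* s c))

    unshifted : ∀ k s → + k ≡ + k + + s * + 0
    unshifted k s = solve 2 (λ a b → a := a :+ b :* Κ 0ℤ) refl (+ k) (+ s)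

  xperm-formula : ∀ s a → toZ (xperm s a) ≈ toZ a + + s * + (toℕ a ℕ.% 2) [ + n ]
  xperm-formula s a with toℕ a ℕ.% 2 | ℕ.m%n<n (toℕ a) 2
  ... | 0 | _ = ≡⇒≈ (unshifted (toℕ a) s)
  ... | 1 | _ = ≈-trans (mod-≈ (toℕ a ℕ.+ s)) (≡⇒≈ (shifted (toℕ a) s 1 (sym (ℕ.*-identityʳ s))))
  ... | suc (suc _) | ℕ.s≤s (ℕ.s≤s ())

  yperm-formula : ∀ s a → toZ (yperm s a) ≈ toZ a + + s * + (toℕ a ℕ.% 2) [ + n ]
  yperm-formula s a with toℕ a ℕ.% 2 | ℕ.m%n<n (toℕ a) 2
  ... | 0 | _ = ≡⇒≈ (unshifted (toℕ a) s)
  ... | 1 | _ = ≈-trans (mod-≈ (toℕ a ℕ.+ s)) (≡⇒≈ (shifted (toℕ a) s 1 (sym (ℕ.*-identityʳ s))))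
  ... | suc (suc _) | ℕ.s≤s (ℕ.s≤s ())

  zperm-formula : ∀ ω s a → toZ (zperm ω s a) ≈ toZ a + + s * + coefficient ω (toℕ a ℕ.% 4) [ + n ]
  zperm-formula ω s a with toℕ a ℕ.% 4
  ... | 0 = ≡⇒≈ (unshifted (toℕ a) s)
  ... | 1 = ≈-trans (mod-≈ (toℕ a ℕ.+ s)) (≡⇒≈ (shifted (toℕ a) s 1 (sym (ℕ.*-identityʳ s))))
  ... | 2 = ≈-trans (mod-≈ (toℕ a ℕ.+ s ℕ.* (ω ℕ.+ 1))) (≡⇒≈ (shifted (toℕ a) s (ω ℕ.+ 1) refl))
  ... | 3 = ≈-trans (mod-≈ (toℕ a ℕ.+ s ℕ.* ω)) (≡⇒≈ (shifted (toℕ a) s ω refl))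
  ... | suc (suc (suc (suc _))) = ≡⇒≈ (unshifted (toℕ a) s)

-- If N ≡ 3 (mod 4) divides ω² + 1, then ω may be taken even and smaller than N; the cofactor of N
-- in ω² + 1 is then again ≡ 3 (mod 4), and it is smaller than N.
3-mod-4⇒no-√-1 : ∀ N → N ℕ.% 4 ≡ 3 → ∀ ω → ¬ + ω * + ω + + 1 ≈ + 0 [ + N ]
3-mod-4⇒no-√-1 N = go N (<-wellFounded N)
  where
  -- The product is 1 modulo 4, and 3 is its own inverse there.
  cofactor-mod : ∀ m N v → N ℕ.% 4 ≡ 3 → 1 ℕ.+ v ℕ.* 4 ≡ m ℕ.* N → m ℕ.% 4 ≡ 3
  cofactor-mod m N v N≡3 e with m ℕ.% 4 | ℕ.m%n<n m 4 | product
    where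
    product : 1 ≡ ((m ℕ.% 4) ℕ.* 3) ℕ.% 4
    product = trans (sym (ℕ.[m+kn]%n≡m%n 1 v 4)) (trans (cong (ℕ._% 4) e)
      (trans (ℕ.%-distribˡ-* m N 4) (cong (λ k → ((m ℕ.% 4) ℕ.* k) ℕ.% 4) N≡3)))
  ... | 0 | _ | ()
  ... | 1 | _ | ()
  ... | 2 | _ | ()
  ... | 3 | _ | _ = refl
  ... | suc (suc (suc (suc _))) | ℕ.s≤s (ℕ.s≤s (ℕ.s≤s (ℕ.s≤s ()))) | _

  go : ∀ N → Acc ℕ._<_ N → N ℕ.% 4 ≡ 3 → ∀ ω → ¬ + ω * + ω + + 1 ≈ + 0 [ + N ]
  go zero _ ()
  go N@(suc N-1) (acc rec) N≡3 ω h = reduce (halve (ω ℕ.% N)) (halve N)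
    where
    r : ℕ
    r = ω ℕ.% N

    r²≈-1 : + r * + r + + 1 ≈ + 0 [ + N ]
    r²≈-1 = shift (residue (+ ω) N)
      where
      shift : ∀ {k} → + ω ≈ + k [ + N ] → + k * + k + + 1 ≈ + 0 [ + N ]
      shift {k} p = lin₂ h p (+ 1) (- (+ ω + + k))
        (solve 2 (λ a b → a :* a :+ Κ 1ℤ :- Κ 0ℤ := Κ 1ℤ :* (b :* b :+ Κ 1ℤ :- Κ 0ℤ) :+
          (:- (b :+ a)) :* (b :- a)) refl (+ k) (+ ω))

    1≤N-1 : 1 ℕ.≤ N-1
    1≤N-1 = positive N-1 N≡3
      where
      positive : ∀ k → suc k ℕ.% 4 ≡ 3 → 1 ℕ.≤ k
      positive zero    ()
      positive (suc k) _ = ℕ.s≤s ℕ.z≤n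

    four-squares : ∀ v → (v ℕ.+ v) ℕ.* (v ℕ.+ v) ≡ (v ℕ.* v) ℕ.* 4
    four-squares = ℕ-Ring.solve-∀

    even-root : ∀ v → v ℕ.+ v ℕ.< N → + (v ℕ.+ v) * + (v ℕ.+ v) + + 1 ≈ + 0 [ + N ] → ⊥
    even-root v 2v<N p = use (subst (N ℕ.∣_) (cong ∣_∣ square) (∣⇒∣ᵤ (≈⇒∣ p)))
      where
      square : + (v ℕ.+ v) * + (v ℕ.+ v) + + 1 ≡ + (1 ℕ.+ (v ℕ.* v) ℕ.* 4)
      square = trans (cong (λ z → z * z + + 1) (pos-+ v v))
        (trans {j = + 1 + (+ v * + v) * + 4}
          (solve 1 (λ a → (a :+ a) :* (a :+ a) :+ Κ 1ℤ := Κ 1ℤ :+ a :* a :* Κ (+ 4)) refl (+ v))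
          (sym (trans (pos-+ 1 _) (cong (λ z → + 1 + z)
            (trans (pos-* (v ℕ.* v) 4) (cong (λ z → z * + 4) (pos-* v v)))))))
      use : N ℕ.∣ 1 ℕ.+ (v ℕ.* v) ℕ.* 4 → ⊥
      use (ℕ.divides m e) = go m (rec m<N) (cofactor-mod m N (v ℕ.* v) N≡3 e) (v ℕ.+ v)
        (∣⇒≈ (divides (+ N) (trans square (trans (cong +_ (trans e (ℕ.*-comm m N))) (pos-* N m)))))
        where
        -- From 2v < N and N ≥ 2 comes m N = 4v² + 1 < N².
        m<N : m ℕ.< N
        m<N = ℕ.*-cancelʳ-< N m N (subst (ℕ._< N ℕ.* N) (trans (cong suc (four-squares v)) e)
          (ℕ.s≤s (ℕ.+-mono-≤ 1≤N-1 (ℕ.*-mono-≤ (ℕ.s≤s⁻¹ 2v<N) (ℕ.<⇒≤ 2v<N)))))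

    reduce : (Σ ℕ λ e → r ≡ e ℕ.+ e ⊎ r ≡ suc (e ℕ.+ e)) → (Σ ℕ λ g → N ≡ g ℕ.+ g ⊎ N ≡ suc (g ℕ.+ g)) → ⊥
    reduce (e , inj₁ r≡2e) _ = even-root e (subst (ℕ._< N) r≡2e (ℕ.m%n<n ω N))
      (subst (λ k → + k * + k + + 1 ≈ + 0 [ + N ]) r≡2e r²≈-1)
    reduce (e , inj₂ r≡2e+1) (g , inj₁ N≡2g) =
      n≢0⇒≉0 {2} {1} (ℕ.s≤s (ℕ.s≤s ℕ.z≤n)) (λ ()) (lin₃ (≡⇒≈ N≡3+4q) (multiple {+ 2} (+ g))
        (multiple {+ 2} (+ 1 + + 2 * + (N ℕ./ 4))) (- + 1) (+ 1) (- + 1)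
          (solve 2 (λ a b → Κ 1ℤ :- Κ 0ℤ := Κ -1ℤ :* (a :+ a :- (Κ (+ 3) :+ b :* Κ (+ 4))) :+ Κ 1ℤ
            :* (a :* Κ (+ 2) :- Κ 0ℤ) :+ Κ -1ℤ :* ((Κ 1ℤ :+ Κ (+ 2) :* b) :* Κ (+ 2) :- Κ 0ℤ)) refl
            (+ g) (+ (N ℕ./ 4))))
      where
      N≡3+4q : + g + + g ≡ + 3 + + (N ℕ./ 4) * + 4
      N≡3+4q = trans (sym (pos-+ g g)) (trans (cong +_ (trans (sym N≡2g) (trans (ℕ.m≡m%n+[m/n]*n N 4)
        (cong (ℕ._+ (N ℕ./ 4) ℕ.* 4) N≡3)))) (cong (λ z → + 3 + z) (pos-* (N ℕ./ 4) 4)))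
    -- An odd root r is replaced by its negative N - r = 2(g - e), which is even because N is odd.
    reduce (e , inj₂ r≡2e+1) (g , inj₂ N≡2g+1) = even-root d 2d<N
      (lin₂ r²≈-1 2d≈-r (+ 1) (+ (d ℕ.+ d) - + r)
        (solve 2 (λ a b → a :* a :+ Κ 1ℤ :- Κ 0ℤ := Κ 1ℤ :* (b :* b :+ Κ 1ℤ :- Κ 0ℤ) :+ (a :- b) :*
          (a :- :- b)) refl (+ (d ℕ.+ d)) (+ r)))
      where
      d : ℕ
      d = g ℕ.∸ e
      e≤g : e ℕ.≤ g
      e≤g = ℕ.≮⇒≥ λ g<e → ℕ.<-asym (ℕ.+-mono-< g<e g<e)
        (ℕ.s<s⁻¹ (subst₂ ℕ._<_ r≡2e+1 N≡2g+1 (ℕ.m%n<n ω N)))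
      2d<N : d ℕ.+ d ℕ.< N
      2d<N = subst (d ℕ.+ d ℕ.<_) (sym N≡2g+1) (ℕ.s≤s (ℕ.+-mono-≤ (ℕ.m∸n≤m g e) (ℕ.m∸n≤m g e)))
      total : d ℕ.+ d ℕ.+ r ≡ N
      total = trans (cong (d ℕ.+ d ℕ.+_) r≡2e+1) (trans (rearrange d e)
        (trans (cong (λ k → suc (k ℕ.+ k)) (ℕ.m+[n∸m]≡n e≤g)) (sym N≡2g+1)))
        where
        rearrange : ∀ d e → d ℕ.+ d ℕ.+ suc (e ℕ.+ e) ≡ suc ((e ℕ.+ d) ℕ.+ (e ℕ.+ d))
        rearrange = ℕ-Ring.solve-∀
      2d≈-r : + (d ℕ.+ d) ≈ - + r [ + N ]
      2d≈-r = lin₂ (≡⇒≈ (trans (sym (pos-+ (d ℕ.+ d) r)) (cong +_ total))) (multiple (+ 1)) (+ 1) (+ 1)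
        (solve 3 (λ a b c → a :- :- b := Κ 1ℤ :* (a :+ b :- (Κ 1ℤ :+ c)) :+ Κ 1ℤ :*
          (Κ 1ℤ :* (Κ 1ℤ :+ c) :- Κ 0ℤ)) refl (+ (d ℕ.+ d)) (+ r) (+ N-1))

-- The three families and their index ranges.

module Main {p : ℕ} (pr : Prime p) (p≢2 : p ≢ 2) (φ : Fin (4 ℕ.* p) → Fin (4 ℕ.* p)) where
  open OddPrime pr p≢2
  open Cyclic (4 ℕ.* p)
    using (IsSkewMorphism; IsAutomorphism; IsProperSkewMorphism; xperm; yperm; zperm)
  open FinLift (4 ℕ.* p)
  open PermutationFormulas (4 ℕ.* p)

  m : ℤ
  m = + (4 ℕ.* p)

  IsX IsY IsZ : Set
  IsX = Σ ℕ λ i → i ℕ.< p × i ≢ (p ℕ.∸ 1) ℕ./ 2 × (∀ a → φ a ≡ xperm (4 ℕ.* i ℕ.+ 2) a)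
  IsY = Σ ℕ λ i → 1 ℕ.≤ i × i ℕ.< p × (∀ a → φ a ≡ yperm (4 ℕ.* i) a)
  IsZ = p ℕ.% 4 ≡ 1 × (Σ ℕ λ ω → p ℕ.∣ ω ℕ.* ω ℕ.+ 1 ×
          (Σ ℕ λ i → 1 ℕ.≤ i × i ℕ.< p × (∀ a → φ a ≡ zperm ω (4 ℕ.* i) a)))

  2∤p : ¬ 2 ℕ.∣ p
  2∤p 2∣p with prime⇒irreducible pr 2∣p
  ... | inj₁ ()
  ... | inj₂ 2≡p = p≢2 (sym 2≡p)

  p-odd : Σ ℕ λ e → p ≡ suc (e ℕ.+ e)
  p-odd with halve p
  ... | e , inj₂ h = e , h
  ... | e , inj₁ h = contradiction (ℕ.divides e (trans h (double e))) 2∤p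
    where
    double : ∀ e → e ℕ.+ e ≡ e ℕ.* 2
    double = ℕ-Ring.solve-∀

  -- The excluded index (p − 1) / 2 is the one with shift 2p, and x_{2p} is multiplication by 1 + 2p.
  2i+1≡p⇔ : ∀ i → i ≡ (p ℕ.∸ 1) ℕ./ 2 ⇔ suc (i ℕ.+ i) ≡ p
  2i+1≡p⇔ i = mk⇔ (λ h → trans (cong (λ k → suc (k ℕ.+ k)) (trans h p-1/2≡e)) (sym p≡))
                  (λ h → sym (trans (cong (λ k → (k ℕ.∸ 1) ℕ./ 2) (sym h)) (half-double i)))
    where
    e = proj₁ p-odd
    p≡ = proj₂ p-odd
    half-double : ∀ e → (e ℕ.+ e) ℕ./ 2 ≡ e
    half-double e = trans (cong (ℕ._/ 2) (double e)) (ℕ.m*n/n≡m e 2)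
      where
      double : ∀ e → e ℕ.+ e ≡ e ℕ.* 2
      double = ℕ-Ring.solve-∀
    p-1/2≡e : (p ℕ.∸ 1) ℕ./ 2 ≡ e
    p-1/2≡e = trans (cong (λ k → (k ℕ.∸ 1) ℕ./ 2) p≡) (half-double e)

  pos-4i : ∀ i → + (4 ℕ.* i) ≡ + 4 * + i
  pos-4i i = pos-* 4 i

  pos-4i+2 : ∀ i → + (4 ℕ.* i ℕ.+ 2) ≡ + 4 * + i + + 2
  pos-4i+2 i = trans (pos-+ (4 ℕ.* i) 2) (cong (λ z → z + + 2) (pos-* 4 i))

  -- Each proper skew morphism belongs to one of the families.

  module Forward (skew : IsSkewMorphism φ) (¬auto : ¬ IsAutomorphism φ) where
    f : ℤ → ℤ
    f = lift φ
    S : Skew m f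
    S = lift-skew skew
    open Skew S using (resp; f0)
    open SkewProperties S using (value-*ℕ; resp-≡)
    open Classification pr p≢2 S using (K; S₄; outcome; module Modulo4)

    nonlinear : ∀ c → ¬ (∀ k → f (+ k) ≈ c * + k [ m ])
    nonlinear c h = ¬auto (proj₁ skew , linear⇒additive {φ} c h)

    ¬ker-1 : ¬ Ker m f (+ 1)
    ¬ker-1 K₁ = nonlinear (f (+ 1)) λ k →
      lin₂ (resp-≡ {+ k} {+ k * + 1}
        (solve 1 (λ a → a := a :* Κ 1ℤ) refl (+ k))) (value-*ℕ {+ 1} k K₁) (+ 1) (+ 1)
        (solve 4 (λ a b c d → a :- b :* c := Κ 1ℤ :* (a :- d) :+ Κ 1ℤ :* (d :- c :* b)) refl
          (f (+ k)) (f (+ 1)) (+ k) (f (+ k * + 1)))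

    step : f (+ 4) ≈ + 4 [ m ] → ∀ k c → f (+ k) ≈ + k + c [ m ] → f (+ (4 ℕ.+ k)) ≈ + (4 ℕ.+ k) + c [ m ]
    step f4≈4 k c h = lin₃ {x = f (+ 4 + + k)} {+ 4 + + k + c} (K (+ k)) f4≈4 h (+ 1) (+ 1) (+ 1)
      (solve 5 (λ a b c d e → a :- (Κ (+ 4) :+ b :+ c) := Κ 1ℤ :* (a :- (d :+ e)) :+ Κ 1ℤ :*
        (d :- Κ (+ 4)) :+ Κ 1ℤ :* (e :- (b :+ c))) refl (f (+ 4 + + k)) (+ k) c (f (+ 4)) (f (+ k)))

    parity-formula : ByParity m f → ∀ k → f (+ k) ≈ + k + (f (+ 1) - + 1) * + (k ℕ.% 2) [ m ]
    parity-formula _ 0 = ≈-trans f0 (≡⇒≈ {+ 0} {+ 0 + (f (+ 1) - + 1) * + 0}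
      (solve 1 (λ a → Κ 0ℤ := Κ 0ℤ :+ (a :- Κ 1ℤ) :* Κ 0ℤ) refl (f (+ 1))))
    parity-formula _ 1 = ≡⇒≈ {f (+ 1)} {+ 1 + (f (+ 1) - + 1) * + 1}
      (solve 1 (λ a → a := Κ 1ℤ :+ (a :- Κ 1ℤ) :* Κ 1ℤ) refl (f (+ 1)))
    parity-formula (_ , f2≈ , _) 2 = ≈-trans f2≈ (≡⇒≈ {+ 2} {+ 2 + (f (+ 1) - + 1) * + 0}
      (solve 1 (λ a → Κ (+ 2) := Κ (+ 2) :+ (a :- Κ 1ℤ) :* Κ 0ℤ) refl (f (+ 1))))
    parity-formula (_ , _ , f3≈) 3 = ≈-trans f3≈ (≡⇒≈ {f (+ 1) + + 2} {+ 3 + (f (+ 1) - + 1) * + 1}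
      (solve 1 (λ a → a :+ Κ (+ 2) := Κ (+ 3) :+ (a :- Κ 1ℤ) :* Κ 1ℤ) refl (f (+ 1))))
    parity-formula h@(f4≈4 , _) (suc (suc (suc (suc k)))) =
      step f4≈4 k ((f (+ 1) - + 1) * + (k ℕ.% 2)) (parity-formula h k)

    fourth-root-formula : (h : ByFourthRoot p m f) → let ω = proj₁ (proj₂ h) in
                          ∀ k → f (+ k) ≈ + k + (f (+ 1) - + 1) * + coefficient ω (k ℕ.% 4) [ m ]
    fourth-root-formula _ 0 = ≈-trans f0 (≡⇒≈ {+ 0} {+ 0 + (f (+ 1) - + 1) * + 0}
      (solve 1 (λ a → Κ 0ℤ := Κ 0ℤ :+ (a :- Κ 1ℤ) :* Κ 0ℤ) refl (f (+ 1))))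
    fourth-root-formula _ 1 = ≡⇒≈ {f (+ 1)} {+ 1 + (f (+ 1) - + 1) * + 1}
      (solve 1 (λ a → a := Κ 1ℤ :+ (a :- Κ 1ℤ) :* Κ 1ℤ) refl (f (+ 1)))
    fourth-root-formula (_ , ω , _ , _ , f2≈ , _) 2 =
      ≈-trans f2≈ (≡⇒≈ (cong (λ z → + 2 + (f (+ 1) - + 1) * z) (sym (pos-+ ω 1))))
    fourth-root-formula (_ , _ , _ , _ , _ , f3≈) 3 = f3≈
    fourth-root-formula h@(f4≈4 , ω , _) (suc (suc (suc (suc k)))) =
      step f4≈4 k ((f (+ 1) - + 1) * + coefficient ω (k ℕ.% 4)) (fourth-root-formula h k)

    index : ∀ {x} → x ≈ + 0 [ + 4 ] → Σ ℕ λ i → i ℕ.< p × x ≈ + 4 * + i [ m ]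
    index {x} x≈0 = go (exact x≈0)
      where
      go : ∀ {x} → (Σ ℤ λ q → x ≡ q * + 4) → Σ ℕ λ i → i ℕ.< p × x ≈ + 4 * + i [ m ]
      go (q , refl) = q %ℕ p , n%ℕd<d q p , move (residue q p)
        where
        move : ∀ {i} → q ≈ i [ + p ] → q * + 4 ≈ + 4 * i [ m ]
        move {i} h = ≈-modulus (sym (pos-* 4 p)) (lin₁ (scale (+ 4) h) (+ 1)
          (solve 2 (λ a b → a :* Κ (+ 4) :- Κ (+ 4) :* b := Κ 1ℤ :* (Κ (+ 4) :* a :- Κ (+ 4) :* b))
            refl q i))

    -- A zero shift makes φ the identity, which is an automorphism; this is what excludes i = 0 for
    -- y_s and z_{ω,s}.
    trivial-shift : (c : ℕ → ℤ) → (∀ k → f (+ k) ≈ + k + (f (+ 1) - + 1) * c k [ m ]) →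
                    ¬ f (+ 1) - + 1 ≈ + 0 [ m ]
    trivial-shift c h s≈0 = nonlinear (+ 1) λ k → lin₂ (h k) s≈0 (+ 1) (c k)
      (solve 4 (λ a b c d → a :- Κ 1ℤ :* b := Κ 1ℤ :* (a :- (b :+ (c :- Κ 1ℤ) :* d)) :+ d :*
        (c :- Κ 1ℤ :- Κ 0ℤ)) refl (f (+ k)) (+ k) (f (+ 1)) (c k))

    index-positive : (c : ℕ → ℤ) → (∀ k → f (+ k) ≈ + k + (f (+ 1) - + 1) * c k [ m ]) →
                     ∀ i → f (+ 1) - + 1 ≈ + 4 * + i [ m ] → 1 ℕ.≤ i
    index-positive c h zero    s≈ = contradiction s≈ (trivial-shift c h)
    index-positive c h (suc i) s≈ = ℕ.s≤s ℕ.z≤n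

    y-type : ByParity m f → f (+ 1) ≈ + 1 [ + 4 ] → IsY
    y-type h f1≈1 = go (index (lin₁ f1≈1 (+ 1)
      (solve 1 (λ a → a :- Κ 1ℤ :- Κ 0ℤ := Κ 1ℤ :* (a :- Κ 1ℤ)) refl (f (+ 1)))))
      where
      formula = parity-formula h
      go : (Σ ℕ λ i → i ℕ.< p × f (+ 1) - + 1 ≈ + 4 * + i [ m ]) → IsY
      go (i , i<p , s≈) = i , index-positive (λ k → + (k ℕ.% 2)) formula i s≈ , i<p
        , identify {φ} {r = f (+ 1) - + 1} {+ (4 ℕ.* i)} (λ k → + (k ℕ.% 2)) formula
            (≈-trans s≈ (≡⇒≈ (sym (pos-4i i)))) (yperm-formula (4 ℕ.* i))

    x-type : ByParity m f → f (+ 1) ≈ - + 1 [ + 4 ] → IsX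
    -- The shift f(1) - 1 is 2 modulo 4, so f(1) - 3 is the part of the form 4i.
    x-type h f1≈-1 = go (index {f (+ 1) - + 3} (lin₂ f1≈-1 (multiple {+ 4} (+ 1)) (+ 1) (- + 1)
      (solve 1 (λ a → a :- Κ (+ 3) :- Κ 0ℤ := Κ 1ℤ :* (a :- Κ -1ℤ) :+ Κ -1ℤ :*
        (Κ 1ℤ :* Κ (+ 4) :- Κ 0ℤ)) refl (f (+ 1)))))
      where
      formula = parity-formula h
      go : (Σ ℕ λ i → i ℕ.< p × f (+ 1) - + 3 ≈ + 4 * + i [ m ]) → IsX
      go (i , i<p , s≈) = i , i<p , not-half
        , identify {φ} {r = f (+ 1) - + 1} {+ (4 ℕ.* i ℕ.+ 2)} (λ k → + (k ℕ.% 2)) formula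
            (lin₂ s≈ (≡⇒≈ (pos-4i+2 i)) (+ 1) (- + 1)
              (solve 3 (λ a b c → a :- Κ 1ℤ :- b := Κ 1ℤ :* (a :- Κ (+ 3) :- Κ (+ 4) :* c) :+ Κ -1ℤ
                :* (b :- (Κ (+ 4) :* c :+ Κ (+ 2)))) refl (f (+ 1)) (+ (4 ℕ.* i ℕ.+ 2)) (+ i)))
            (xperm-formula (4 ℕ.* i ℕ.+ 2))
        where
        not-half : i ≢ (p ℕ.∸ 1) ℕ./ 2
        not-half i≡ = nonlinear (+ 1 + + 2 * + p) λ k → linear k
          where
          p≡ : + 1 + (+ i + + i) ≡ + p
          p≡ = trans (cong (λ z → + 1 + z) (sym (pos-+ i i))) (cong +_ (Equivalence.to (2i+1≡p⇔ i) i≡))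
          linear : ∀ k → f (+ k) ≈ (+ 1 + + 2 * + p) * + k [ m ]
          -- The shift is 2p on odd residues, and 2p (k mod 2) ≡ 2p k modulo 4p.
          linear k = lin₄ (formula k) s≈ (≡⇒≈ p≡)
            (lin₂ {x = + 2 * + p * + (k ℕ.% 2)} {+ 2 * + p * + k}
              (≡⇒≈ k≡) (≈-modulus (sym (pos-* 4 p)) (multiple (+ (k ℕ./ 2)))) (- (+ 2 * + p)) (- + 1)
                (solve 4 (λ a b c d → Κ (+ 2) :* a :* b :- Κ (+ 2) :* a :* c := (:- (Κ (+ 2) :* a))
                  :* (c :- (b :+ d :* Κ (+ 2))) :+ Κ -1ℤ :* (d :* (Κ (+ 4) :* a) :- Κ 0ℤ)) refl
                  (+ p) (+ (k ℕ.% 2)) (+ k) (+ (k ℕ./ 2))))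
            (+ 1) (+ (k ℕ.% 2)) (+ 2 * + (k ℕ.% 2)) (+ 1)
              (solve 6 (λ a b c d e g → a :- (Κ 1ℤ :+ Κ (+ 2) :* b) :* c := Κ 1ℤ :*
                (a :- (c :+ (d :- Κ 1ℤ) :* e)) :+ e :* (d :- Κ (+ 3) :- Κ (+ 4) :* g) :+ Κ (+ 2) :*
                e :* (Κ 1ℤ :+ (g :+ g) :- b) :+ Κ 1ℤ :* (Κ (+ 2) :* b :* e :- Κ (+ 2) :* b :* c))
                refl (f (+ k)) (+ p) (+ k) (f (+ 1)) (+ (k ℕ.% 2)) (+ i))
            where
            k≡ : + k ≡ + (k ℕ.% 2) + + (k ℕ./ 2) * + 2
            k≡ = a≡a%ℕn+[a/ℕn]*n (+ k) 2

    p≡1-mod-4 : ∀ ω → + ω * + ω + + 1 ≈ + 0 [ + p ] → p ℕ.% 4 ≡ 1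
    p≡1-mod-4 ω h = cases (p ℕ.% 4) refl (ℕ.m%n<n p 4)
      where
      even : ∀ r → p ℕ.% 4 ≡ r ℕ.* 2 → 2 ℕ.∣ p
      even r e = ℕ.divides (r ℕ.+ (p ℕ./ 4) ℕ.* 2)
        (trans (trans (ℕ.m≡m%n+[m/n]*n p 4) (cong (ℕ._+ (p ℕ./ 4) ℕ.* 4) e)) (rearrange r (p ℕ./ 4)))
        where
        rearrange : ∀ r q → r ℕ.* 2 ℕ.+ q ℕ.* 4 ≡ (r ℕ.+ q ℕ.* 2) ℕ.* 2
        rearrange = ℕ-Ring.solve-∀
      cases : ∀ r → p ℕ.% 4 ≡ r → r ℕ.< 4 → p ℕ.% 4 ≡ 1
      cases 0 e _ = contradiction (even 0 e) 2∤p
      cases 1 e _ = e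
      cases 2 e _ = contradiction (even 1 e) 2∤p
      cases 3 e _ = contradiction h (3-mod-4⇒no-√-1 p e ω)
      cases (suc (suc (suc (suc _)))) _ (ℕ.s≤s (ℕ.s≤s (ℕ.s≤s (ℕ.s≤s ()))))

    z-type : ByFourthRoot p m f → IsZ
    z-type h@(_ , ω , ω²≈-1 , f1≈1 , _) = p≡1-mod-4 ω ω²≈-1 , ω
      , subst (p ℕ.∣_)
          (cong ∣_∣ (trans (cong (λ z → z + + 1) (sym (pos-* ω ω))) (sym (pos-+ (ω ℕ.* ω) 1))))
          (∣⇒∣ᵤ (≈⇒∣ ω²≈-1))
      , go (index (lin₁ f1≈1 (+ 1)
        (solve 1 (λ a → a :- Κ 1ℤ :- Κ 0ℤ := Κ 1ℤ :* (a :- Κ 1ℤ)) refl (f (+ 1)))))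
      where
      formula = fourth-root-formula h
      go : (Σ ℕ λ i → i ℕ.< p × f (+ 1) - + 1 ≈ + 4 * + i [ m ]) →
           Σ ℕ λ i → 1 ℕ.≤ i × i ℕ.< p × (∀ a → φ a ≡ zperm ω (4 ℕ.* i) a)
      go (i , i<p , s≈) = i , index-positive (λ k → + coefficient ω (k ℕ.% 4)) formula i s≈ , i<p
        , identify {φ} {r = f (+ 1) - + 1} {+ (4 ℕ.* i)} (λ k → + coefficient ω (k ℕ.% 4)) formula
            (≈-trans s≈ (≡⇒≈ (sym (pos-4i i))))
            (zperm-formula ω (4 ℕ.* i))

    -- For the parity type, the sign of f modulo 4 tells whether the shift f(1) - 1 is 0 or 2 modulo
    -- 4, that is, whether φ is some y_s or some x_s.
    classify : IsX ⊎ IsY ⊎ IsZ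
    classify = [ (λ K₁ → contradiction K₁ ¬ker-1)
      , [ (λ h → [ (λ fixed → inj₂ (inj₁ (y-type h (fixed (+ 1)))))
                 , (λ negative → inj₁ (x-type h (negative (+ 1)))) ]′ Modulo4.sign)
        , (λ h → inj₂ (inj₂ (z-type h))) ]′ ]′ outcome

  -- Each member of the families is a proper skew morphism.

  module Reverse {s : ℕ} {c : ℕ → ℤ} (formula : ∀ a → toZ (φ a) ≈ toZ a + + s * c (toℕ a) [ m ]) where
    module _ {ω d : ℕ} .{{_ : NonZero d}} (0<ω : 0 ℕ.< ω)
             (4p≈0 : m ≈ + 0 [ + d ]) (s≈0 : + s ≈ + 0 [ + d ])
             (c-periodic : ∀ k → c (d ℕ.+ k) ≡ c k)
             (geometric≈c : ∀ k → + s * geometric (+ ω) k ≈ + s * c k [ m ])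
             (proper : ¬ + s * (+ ω - + 1) ≈ + 0 [ m ]) where

      -- The reduced coefficient c and the geometric sum agree after multiplication by s, so the
      -- results on shifts by geometric sums apply.
      isProper : IsProperSkewMorphism φ
      isProper = isSkewMorphism , λ auto → proper (additive⇒ (proj₂ auto))
        where
        formula′ : ∀ a → toZ (φ a) ≈ toZ a + + s * geometric (+ ω) (toℕ a) [ m ]
        formula′ a = ≈-trans (formula a) (exchange (toZ a) (geometric≈c (toℕ a)))
          where
          exchange : ∀ x {y z} → y ≈ z [ m ] → x + z ≈ x + y [ m ]
          exchange x {y} {z} h = lin₁ h (- + 1)
            (solve 3 (λ a b c → a :+ b :- (a :+ c) := Κ -1ℤ :* (c :- b)) refl x z y)
        periodic : ∀ k → + s * geometric (+ ω) (d ℕ.+ k) ≈ + s * geometric (+ ω) k [ m ]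
        periodic k = ≈-trans (geometric≈c (d ℕ.+ k))
          (≈-trans (≡⇒≈ (cong (λ z → + s * z) (c-periodic k))) (≈-sym (geometric≈c k)))
        open ShiftByGeometric {φ} {ω} {d} {+ s} 0<ω formula′ 4p≈0 s≈0 periodic

  4p≈0-mod-2 : m ≈ + 0 [ + 2 ]
  4p≈0-mod-2 = ≈-trans (≡⇒≈ (pos-* 4 p)) (lin₁ (multiple (+ 2 * + p)) (+ 1)
    (solve 1 (λ a → Κ (+ 4) :* a :- Κ 0ℤ := Κ 1ℤ :* (Κ (+ 2) :* a :* Κ (+ 2) :- Κ 0ℤ)) refl (+ p)))

  4p≈0-mod-4 : m ≈ + 0 [ + 4 ]
  4p≈0-mod-4 = ≈-trans (≡⇒≈ (pos-* 4 p)) (lin₁ (multiple (+ p)) (+ 1)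
    (solve 1 (λ a → Κ (+ 4) :* a :- Κ 0ℤ := Κ 1ℤ :* (a :* Κ (+ 4) :- Κ 0ℤ)) refl (+ p)))

  -- A positive representative 4p - 1 of the ratio -1: powers of the ratio serve as iteration
  -- exponents, so it has to be a natural number.
  ν : ℕ
  ν = ℕ.pred (4 ℕ.* p)

  suc-ν : suc ν ≡ 4 ℕ.* p
  suc-ν = ℕ.suc-pred (4 ℕ.* p)

  0<ν : 0 ℕ.< ν
  0<ν = ℕ.s<s⁻¹ (subst (1 ℕ.<_) (sym suc-ν) (ℕ.*-mono-≤ (ℕ.s≤s (ℕ.s≤s (ℕ.z≤n {2}))) (ℕ.<⇒≤ 1<p)))

  ν≈-1 : + ν ≈ - + 1 [ m ]
  ν≈-1 = go (trans (sym (pos-+ 1 ν)) (cong +_ suc-ν))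
    where
    go : + 1 + + ν ≡ m → + ν ≈ - + 1 [ m ]
    go e = lin₂ (≡⇒≈ e) (multiple (+ 1)) (+ 1) (+ 1)
      (solve 2 (λ a b → a :- Κ -1ℤ := Κ 1ℤ :* (Κ 1ℤ :+ a :- b) :+ Κ 1ℤ :* (Κ 1ℤ :* b :- Κ 0ℤ)) refl
        (+ ν) m)

  geometric-ν : ∀ k → geometric (+ ν) k ≈ + (k ℕ.% 2) [ m ]
  geometric-ν 0 = ≈-refl
  geometric-ν 1 = ≡⇒≈ {+ 1 + + ν * + 0} (solve 1 (λ a → Κ 1ℤ :+ a :* Κ 0ℤ := Κ 1ℤ) refl (+ ν))
  geometric-ν (suc (suc k)) = ≈-trans (step (geometric (+ ν) k) ν≈-1) (geometric-ν k)
    where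
    step : ∀ g {v} → v ≈ - + 1 [ m ] → + 1 + v * (+ 1 + v * g) ≈ g [ m ]
    step g {v} h = lin₁ h (+ 1 + (v - + 1) * g)
      (solve 2 (λ a b → Κ 1ℤ :+ a :* (Κ 1ℤ :+ a :* b) :- b := (Κ 1ℤ :+ (a :- Κ 1ℤ) :* b) :*
        (a :- Κ -1ℤ)) refl v g)

  -- With ratio -1, additivity would force -2s ≡ 0 modulo 4p.
  parity-shift⇒proper : ∀ s → (∀ a → toZ (φ a) ≈ toZ a + + s * + (toℕ a ℕ.% 2) [ m ]) →
                        + s ≈ + 0 [ + 2 ] → ¬ + 2 * + s ≈ + 0 [ m ] → IsProperSkewMorphism φ
  parity-shift⇒proper s formula s≈0 2s≉0 =
    Reverse.isProper {s} {λ k → + (k ℕ.% 2)} formula {ν} {2} 0<ν 4p≈0-mod-2 s≈0 (λ k → refl)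
      (λ k → *-monoʳ (+ s) (geometric-ν k)) (λ h → 2s≉0 (double ν≈-1 h))
    where
    double : ∀ {v} → v ≈ - + 1 [ m ] → + s * (v - + 1) ≈ + 0 [ m ] → + 2 * + s ≈ + 0 [ m ]
    double {v} p h = lin₂ h p (- + 1) (+ s)
      (solve 2 (λ a b → Κ (+ 2) :* a :- Κ 0ℤ := Κ -1ℤ :* (a :* (b :- Κ 1ℤ) :- Κ 0ℤ) :+ a :*
        (b :- Κ -1ℤ)) refl (+ s) v)

  small≉0 : ∀ {i} → 1 ℕ.≤ i → i ℕ.< p → ¬ + i ≈ + 0 [ + p ]
  small≉0 1≤i i<p = n≢0⇒≉0 i<p (λ i≡0 → ℕ.<⇒≢ 1≤i (sym i≡0))

  -- 2s = 4(2i + 1) vanishes modulo 4p only if p divides 2i + 1, which for i < p means 2i + 1 = p,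
  -- the excluded index.
  x⇒proper : IsX → IsProperSkewMorphism φ
  x⇒proper (i , i<p , i≢ , h) = parity-shift⇒proper (4 ℕ.* i ℕ.+ 2)
    (λ a → ≈-trans (≡⇒≈ (cong toZ (h a))) (xperm-formula (4 ℕ.* i ℕ.+ 2) a))
    (≈-trans (≡⇒≈ (pos-4i+2 i)) (lin₁ (multiple (+ 2 * + i + + 1)) (+ 1)
      (solve 1 (λ a → Κ (+ 4) :* a :+ Κ (+ 2) :- Κ 0ℤ := Κ 1ℤ :*
        ((Κ (+ 2) :* a :+ Κ 1ℤ) :* Κ (+ 2) :- Κ 0ℤ)) refl (+ i))))
    (λ 2s≈0 → divisible (subst (p ℕ.∣_) (cong ∣_∣ cast) (∣⇒∣ᵤ (≈⇒∣ (quarter (pos-4i+2 i) 2s≈0)))))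
    where
    quarter : ∀ {s} → s ≡ + 4 * + i + + 2 → + 2 * s ≈ + 0 [ m ] → + 1 + (+ i + + i) ≈ + 0 [ + p ]
    quarter refl h = unscale (+ 4) (≈-modulus (pos-* 4 p) (lin₁ h (+ 1)
      (solve 1 (λ a → Κ (+ 4) :* (Κ 1ℤ :+ (a :+ a)) :- Κ (+ 4) :* Κ 0ℤ := Κ 1ℤ :*
        (Κ (+ 2) :* (Κ (+ 4) :* a :+ Κ (+ 2)) :- Κ 0ℤ)) refl (+ i))))
    cast : + 1 + (+ i + + i) ≡ + suc (i ℕ.+ i)
    cast = trans (cong (λ z → + 1 + z) (sym (pos-+ i i))) (sym (pos-+ 1 (i ℕ.+ i)))
    divisible : p ℕ.∣ suc (i ℕ.+ i) → ⊥
    divisible (ℕ.divides 0 ())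
    divisible (ℕ.divides 1 e) = i≢ (Equivalence.from (2i+1≡p⇔ i) (trans e (ℕ.*-identityˡ p)))
    -- A quotient of at least 2 would give 2i + 1 ≥ 2p, against i < p.
    divisible (ℕ.divides (suc (suc q)) e) = ℕ.<⇒≱
      (subst (ℕ._≤ p ℕ.+ p) (cong suc (ℕ.+-suc i i)) (ℕ.+-mono-≤ i<p i<p))
      (subst (p ℕ.+ p ℕ.≤_) (trans (ℕ.+-assoc p p (q ℕ.* p)) (sym e)) (ℕ.m≤m+n (p ℕ.+ p) (q ℕ.* p)))

  y⇒proper : IsY → IsProperSkewMorphism φ
  y⇒proper (i , 1≤i , i<p , h) = parity-shift⇒proper (4 ℕ.* i)
    (λ a → ≈-trans (≡⇒≈ (cong toZ (h a))) (yperm-formula (4 ℕ.* i) a))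
    (≈-trans (≡⇒≈ (pos-4i i)) (lin₁ (multiple (+ 2 * + i)) (+ 1)
      (solve 1 (λ a → Κ (+ 4) :* a :- Κ 0ℤ := Κ 1ℤ :* (Κ (+ 2) :* a :* Κ (+ 2) :- Κ 0ℤ)) refl (+ i))))
    (λ 2s≈0 → [ 2≉0 , small≉0 1≤i i<p ]′ (euclid pr (+ 2) (+ i) (quarter (pos-4i i) 2s≈0)))
    where
    quarter : ∀ {s} → s ≡ + 4 * + i → + 2 * s ≈ + 0 [ m ] → + 2 * + i ≈ + 0 [ + p ]
    quarter refl h = unscale (+ 4) (≈-modulus (pos-* 4 p) (lin₁ h (+ 1)
      (solve 1 (λ a → Κ (+ 4) :* (Κ (+ 2) :* a) :- Κ (+ 4) :* Κ 0ℤ := Κ 1ℤ :*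
        (Κ (+ 2) :* (Κ (+ 4) :* a) :- Κ 0ℤ)) refl (+ i))))

  -- Four consecutive terms cancel, since 1 + ω + ω² + ω³ = (1 + ω)(1 + ω²) and ω⁴ ≡ 1; so the sum
  -- has period 4 modulo p.
  geometric-√-1 : ∀ {ω} → + ω * + ω + + 1 ≈ + 0 [ + p ] →
                  ∀ k → geometric (+ ω) k ≈ + coefficient ω (k ℕ.% 4) [ + p ]
  geometric-√-1 h 0 = ≈-refl
  geometric-√-1 {ω} h 1 = ≡⇒≈ {+ 1 + + ω * + 0}
    (solve 1 (λ a → Κ 1ℤ :+ a :* Κ 0ℤ := Κ 1ℤ) refl (+ ω))
  geometric-√-1 {ω} h 2 = ≡⇒≈ (trans {j = + ω + + 1} two (sym (pos-+ ω 1)))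
    where
    two : + 1 + + ω * (+ 1 + + ω * + 0) ≡ + ω + + 1
    two = solve 1 (λ a → Κ 1ℤ :+ a :* (Κ 1ℤ :+ a :* Κ 0ℤ) := a :+ Κ 1ℤ) refl (+ ω)
  geometric-√-1 {ω} h 3 = lin₁ {x = + 1 + + ω * (+ 1 + + ω * (+ 1 + + ω * + 0))} {+ ω} h (+ 1)
    (solve 1 (λ a → Κ 1ℤ :+ a :* (Κ 1ℤ :+ a :* (Κ 1ℤ :+ a :* Κ 0ℤ)) :- a := Κ 1ℤ :*
      (a :* a :+ Κ 1ℤ :- Κ 0ℤ)) refl (+ ω))
  geometric-√-1 {ω} h (suc (suc (suc (suc k)))) = ≈-trans (step (geometric (+ ω) k)) (geometric-√-1 h k)
    where
    step : ∀ g → + 1 + + ω * (+ 1 + + ω * (+ 1 + + ω * (+ 1 + + ω * g))) ≈ g [ + p ]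
    step g = lin₁ h (+ 1 + + ω + (+ ω * + ω - + 1) * g)
      (solve 2 (λ a b → Κ 1ℤ :+ a :* (Κ 1ℤ :+ a :* (Κ 1ℤ :+ a :* (Κ 1ℤ :+ a :* b))) :- b :=
        (Κ 1ℤ :+ a :+ (a :* a :- Κ 1ℤ) :* b) :* (a :* a :+ Κ 1ℤ :- Κ 0ℤ)) refl (+ ω) g)

  z⇒proper : IsZ → IsProperSkewMorphism φ
  z⇒proper (_ , ω , p∣ω²+1 , i , 1≤i , i<p , h) =
    Reverse.isProper {4 ℕ.* i} {λ k → + coefficient ω (k ℕ.% 4)}
      (λ a → ≈-trans (≡⇒≈ (cong toZ (h a))) (zperm-formula ω (4 ℕ.* i) a))
      {ω} {4} (positive ω p∣ω²+1) 4p≈0-mod-4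
      (≈-trans (≡⇒≈ (pos-4i i)) (lin₁ (multiple (+ i)) (+ 1)
        (solve 1 (λ a → Κ (+ 4) :* a :- Κ 0ℤ := Κ 1ℤ :* (a :* Κ (+ 4) :- Κ 0ℤ)) refl (+ i))
        )) (λ k → refl)
      (λ k → scaled (pos-4i i) (geometric-√-1 ω²≈-1 k))
      -- Additivity would force p to divide i(ω - 1), and ω ≡ 1 would turn ω² + 1 ≡ 0 into 2 ≡ 0.
      (λ s≈0 → [ small≉0 1≤i i<p , (λ ω≈1 → 2≉0 (lin₂ ω²≈-1 ω≈1 (+ 1) (- (+ ω + + 1))
        (solve 1 (λ a → Κ (+ 2) :- Κ 0ℤ := Κ 1ℤ :* (a :* a :+ Κ 1ℤ :- Κ 0ℤ) :+ (:- (a :+ Κ 1ℤ)) :*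
          (a :- Κ 1ℤ :- Κ 0ℤ)) refl (+ ω)))) ]′
        (euclid pr (+ i) (+ ω - + 1) (quarter (pos-4i i) s≈0)))
    where
    ω²≈-1 : + ω * + ω + + 1 ≈ + 0 [ + p ]
    ω²≈-1 = ≈-trans (≡⇒≈ (trans (cong (λ z → z + + 1) (sym (pos-* ω ω))) (sym (pos-+ (ω ℕ.* ω) 1))))
      (∣⇒≈ (∣ᵤ⇒∣ p∣ω²+1))
    positive : ∀ ω → p ℕ.∣ ω ℕ.* ω ℕ.+ 1 → 0 ℕ.< ω
    positive zero    p∣1 = contradiction (ℕ.∣⇒≤ p∣1) (ℕ.<⇒≱ 1<p)
    positive (suc _) _   = ℕ.s≤s ℕ.z≤n
    scaled : ∀ {s x y} → s ≡ + 4 * + i → x ≈ y [ + p ] → s * x ≈ s * y [ m ]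
    scaled {x = x} {y} refl h = ≈-modulus (sym (pos-* 4 p)) (lin₁ (scale (+ 4) h) (+ i)
      (solve 3 (λ a b c → Κ (+ 4) :* a :* b :- Κ (+ 4) :* a :* c := a :*
        (Κ (+ 4) :* b :- Κ (+ 4) :* c)) refl (+ i) x y))
    quarter : ∀ {s} → s ≡ + 4 * + i → s * (+ ω - + 1) ≈ + 0 [ m ] → + i * (+ ω - + 1) ≈ + 0 [ + p ]
    quarter refl h = unscale (+ 4) (≈-modulus (pos-* 4 p) (lin₁ h (+ 1)
      (solve 2 (λ a b → Κ (+ 4) :* (a :* (b :- Κ 1ℤ)) :- Κ (+ 4) :* Κ 0ℤ := Κ 1ℤ :*
        (Κ (+ 4) :* a :* (b :- Κ 1ℤ) :- Κ 0ℤ)) refl (+ i) (+ ω))))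

theorem6p3 : (p : ℕ) (pr : Prime p) → p ≢ 2 →
    let open Cyclic (4 ℕ.* p) {{nz4p pr}} in
    (φ : Fin (4 ℕ.* p) → Fin (4 ℕ.* p)) →
    IsProperSkewMorphism φ ⇔
    ((Σ ℕ λ i → i ℕ.< p × i ≢ (p ℕ.∸ 1) ℕ./ 2 × (∀ a → φ a ≡ xperm (4 ℕ.* i ℕ.+ 2) a))
    ⊎ (Σ ℕ λ i → 1 ℕ.≤ i × i ℕ.< p × (∀ a → φ a ≡ yperm (4 ℕ.* i) a))
    ⊎ (p ℕ.% 4 ≡ 1 × (Σ ℕ λ ω → p ℕ.∣ ω ℕ.* ω ℕ.+ 1 ×
    (Σ ℕ λ i → 1 ℕ.≤ i × i ℕ.< p × (∀ a → φ a ≡ zperm ω (4 ℕ.* i) a)))))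
theorem6p3 p pr p≢2 φ = mk⇔
  (λ (skew , ¬auto) → Forward.classify skew ¬auto)
  [ x⇒proper , [ y⇒proper , z⇒proper ]′ ]′
  where open Main pr p≢2 φ
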